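{- Let $q\in\{2,3\}$ and let $M$ be a simple $GF(q)$-representable matroid, regarded as a restriction of $PG(r(M)-1,q)$, i.e. $E(M)\subseteq E(PG(r(M)-1,q))$. Then $M$ is a $GF(q)$-comatroid if and only if either $M$ is $U_{0,0}$, or for every flat $F$ of $PG(r(M)-1,q)$ with $r(F\cap E(M))=r(F-E(M))$, at least one of the matroids $PG(r(M)-1,q)|(F\cap E(M))$ and $PG(r(M)-1,q)|(F-E(M))$ is disconnected.
   Context: All matroids are simple. For $q\in\{2,3\}$ every simple $GF(q)$-representable matroid $M$ is uniquely $GF(q)$-representable, so for each $k\ge r(M)$ one can write $M\cong PG(k-1,q)|T$ for some set $T$, and the $(GF(q),k)$-complement of $M$ is the matroid $PG(k-1,q)\backslash T$, which is well defined up to isomorphism. A $GF(q)$-comatroid is defined recursively: (i) $U_{0,0}$ is a $GF(q)$-comatroid; (ii) the direct sum of two $GF(q)$-comatroids is a $GF(q)$-comatroid; (iii) if $M$ is a $GF(q)$-comatroid then so is its $(GF(q),t)$-complement for every $t\ge r(M)$. Ranks of subsets are ranks in $PG(r(M)-1,q)$.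
   Formalization: The flat condition is required only for nonempty flats F; with the empty flat, both restrictions are U_{0,0}, which is connected and of equal rank 0, so the condition would fail for every M, e.g. for the comatroid U_{1,1}. -}

module Defs where

open import Data.Nat using (ℕ; zero; suc; _+_; _≤_)
open import Data.Nat.DivMod using (_mod_)
open import Data.Fin using (Fin; toℕ)
import Data.Fin as Fin
open import Data.Fin.Properties using () renaming (_≟_ to _≟F_)
open import Data.Bool using (Bool; true; false; _∧_; _∨_; not; if_then_else_)
open import Data.Vec using (Vec; []; _∷_; replicate; zipWith; map; take; drop; _++_)
open import Data.Vec.Properties using (≡-dec)
open import Data.List using (List; []; _∷_; length; zip)
import Data.List as List
open import Data.List.Relation.Unary.All using (All)
open import Data.Maybe using (Maybe; just; nothing; maybe)
open import Data.Product using (Σ; ∃; _×_; _,_; proj₁)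
open import Data.Sum using (_⊎_)
open import Relation.Binary.PropositionalEquality using (_≡_; refl)
open import Relation.Nullary.Decidable using (⌊_⌋)
open import Function.Bundles using (_↔_; Inverse)

data Field : Set where
  GF2 GF3 : Field

card : Field → ℕ
card GF2 = 2
card GF3 = 3

Fq : Field → Set
Fq F = Fin (card F)

0F : (F : Field) → Fq F
0F GF2 = Fin.zero
0F GF3 = Fin.zero

addF : (F : Field) → Fq F → Fq F → Fq F
addF GF2 a b = (toℕ a + toℕ b) mod 2
addF GF3 a b = (toℕ a + toℕ b) mod 3

mulF : (F : Field) → Fq F → Fq F → Fq F
mulF GF2 a b = (toℕ a Data.Nat.* toℕ b) mod 2
mulF GF3 a b = (toℕ a Data.Nat.* toℕ b) mod 3

zeroV : (F : Field) (k : ℕ) → Vec (Fq F) k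
zeroV F k = replicate k (0F F)

comb : (F : Field) {k : ℕ} → List (Fq F × Vec (Fq F) k) → Vec (Fq F) k
comb F {k} [] = zeroV F k
comb F ((c , v) ∷ r) = zipWith (addF F) (map (mulF F c) v) (comb F r)

LinInd : (F : Field) {k : ℕ} → List (Vec (Fq F) k) → Set
LinInd F {k} vs = (cs : List (Fq F)) → length cs ≡ length vs →
  comb F (zip cs vs) ≡ zeroV F k → All (λ c → c ≡ 0F F) cs

-- Points of PG(k-1,q): nonzero vectors whose first nonzero entry is 1
-- (one canonical representative per 1-dimensional subspace)

isZ : {n : ℕ} → Fin n → Bool
isZ Fin.zero = true
isZ (Fin.suc _) = false

isO : {n : ℕ} → Fin n → Bool
isO Fin.zero = false
isO (Fin.suc Fin.zero) = true
isO (Fin.suc (Fin.suc _)) = false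

norm? : {n k : ℕ} → Vec (Fin n) k → Bool
norm? [] = false
norm? (x ∷ v) = if isZ x then norm? v else isO x

isZeroV : {n k : ℕ} → Vec (Fin n) k → Bool
isZeroV [] = true
isZeroV (x ∷ v) = isZ x ∧ isZeroV v

Pt : (F : Field) (k : ℕ) → Set
Pt F k = Σ (Vec (Fq F) k) (λ v → norm? v ≡ true)

PSet : (F : Field) (k : ℕ) → Set
PSet F k = Pt F k → Bool

mkPt? : {F : Field} {k : ℕ} → Vec (Fq F) k → Maybe (Pt F k)
mkPt? v with norm? v in eq
... | true = just (v , eq)
... | false = nothing

memV : {F : Field} {k : ℕ} → PSet F k → Vec (Fq F) k → Bool
memV T v = maybe T false (mkPt? v)

_∩_ : {F : Field} {k : ℕ} → PSet F k → PSet F k → PSet F k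
(A ∩ B) p = A p ∧ B p

_─_ : {F : Field} {k : ℕ} → PSet F k → PSet F k → PSet F k
(A ─ B) p = A p ∧ not (B p)

addPt : {F : Field} {k : ℕ} → PSet F k → Pt F k → PSet F k
addPt S p x = S x ∨ ⌊ ≡-dec _≟F_ (proj₁ x) (proj₁ p) ⌋

InSet : {F : Field} {k : ℕ} → PSet F k → List (Pt F k) → Set
InSet S xs = All (λ p → S p ≡ true) xs

IndepIn : (F : Field) {k : ℕ} → PSet F k → List (Pt F k) → Set
IndepIn F S xs = InSet S xs × LinInd F (List.map proj₁ xs)

IsRank : (F : Field) {k : ℕ} → PSet F k → ℕ → Set
IsRank F S n =
  (Σ (List _) λ xs → IndepIn F S xs × length xs ≡ n) ×
  ((xs : List _) → IndepIn F S xs → length xs ≤ n)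

SameRank : (F : Field) {k : ℕ} → PSet F k → PSet F k → Set
SameRank F A B = Σ ℕ λ n → IsRank F A n × IsRank F B n

IsFlat : (F : Field) {k : ℕ} → PSet F k → Set
IsFlat F S = (p : Pt F _) → S p ≡ false →
  (n : ℕ) → IsRank F S n → IsRank F (addPt S p) (suc n)

NonEmpty : {F : Field} {k : ℕ} → PSet F k → Set
NonEmpty S = Σ (Pt _ _) λ p → S p ≡ true

IsEmpty : {F : Field} {k : ℕ} → PSet F k → Set
IsEmpty S = (p : Pt _ _) → S p ≡ false

Disconnected : (F : Field) {k : ℕ} → PSet F k → Set
Disconnected F X = Σ (PSet F _) λ A →
  ((p : Pt F _) → A p ≡ true → X p ≡ true) ×
  NonEmpty A × NonEmpty (X ─ A) ×
  Σ ℕ λ a → Σ ℕ λ b → IsRank F A a × IsRank F (X ─ A) b × IsRank F X (a + b)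

Elem : {F : Field} {k : ℕ} → PSet F k → Set
Elem T = Σ (Pt _ _) λ p → T p ≡ true

vecOf : {F : Field} {k : ℕ} {T : PSet F k} → Elem T → Vec (Fq F) k
vecOf ((v , _) , _) = v

MatIso : (F : Field) {k l : ℕ} → PSet F k → PSet F l → Set
MatIso F {k} {l} T U = Σ (Elem T ↔ Elem U) λ φ →
  (xs : List (Elem T)) →
    (LinInd F (List.map vecOf xs) → LinInd F (List.map (λ x → vecOf {T = U} (Inverse.to φ x)) xs)) ×
    (LinInd F (List.map (λ x → vecOf {T = U} (Inverse.to φ x)) xs) → LinInd F (List.map vecOf xs))

-- Direct sum, realised in PG(k+l-1,q) on complementary coordinate blocks

dsumSet : {F : Field} {k l : ℕ} → PSet F k → PSet F l → PSet F (k + l)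
dsumSet {k = k} T U (v , _) =
  (isZeroV (drop k v) ∧ memV T (take k v)) ∨ (isZeroV (take k v) ∧ memV U (drop k v))

data IsCo (F : Field) : {k : ℕ} → PSet F k → Set where
  co-empty : IsCo F {0} (λ _ → false)
  co-sum : {k l : ℕ} {T : PSet F k} {U : PSet F l} →
    IsCo F T → IsCo F U → IsCo F (dsumSet T U)
  co-compl : {k : ℕ} {T : PSet F k} → IsCo F T →
    (t : ℕ) (S : PSet F t) → MatIso F S T → IsCo F {t} (λ p → not (S p))
  -- the class consists of matroids up to isomorphism
  co-iso : {k l : ℕ} {T : PSet F k} {U : PSet F l} →
    IsCo F T → MatIso F U T → IsCo F U

-- Call a set E of points good if it satisfies the flat condition.  Write r for rank.  A subspace W
-- not contained in a subspace V is spanned by W − V; so if E ∩ W lies in V, then r(E ∩ W) < r(W − E),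
-- and goodness only concerns flats inside the span of E.  Hence goodness passes to subspaces and to
-- larger ambient spaces, and it is symmetric in E and its complement.
--
-- Comatroids are good.  For E = T ⊕ U and a flat W, either E ∩ W meets both summands and is
-- disconnected, or E ∩ W lies in one summand.  Invariance under matroid isomorphism is unique
-- representability: let x e and y e be the coordinates of an element in two representations, relative
-- to a common basis.  Process the elements one at a time, keeping the connected components as classes
-- of coordinates and a diagonal sign matrix s with y j = ± s x j.  For a new element e put
-- z = s y e; a cocircuit functional vanishes on x e iff it vanishes on z, so, over GF(2) and GF(3), it
-- vanishes on x e + z or on x e − z.  Since any two nonzero coordinates in one component are detected
-- by a common cocircuit, z = ± x e on every component, and flipping signs of components extends s.
--
-- Good sets are comatroids, by induction on the dimension k.  If E or its complement has rank less
-- than k, pass to its span.  Otherwise the whole space is a flat to which the condition applies, so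
-- E or its complement is a direct sum of good sets of smaller rank.

module Submission where

open import Defs

open import Axiom.UniquenessOfIdentityProofs.WithK using (uip)
open import Data.Bool using (Bool; true; false; not; _∧_; _∨_)
import Data.Bool.Properties as Boolₚ
open Boolₚ using () renaming (_≟_ to _≟ᵇ_)
open import Data.Fin as Fin using (Fin)
import Data.Fin.Properties as Finₚ
open import Data.List as List using (List; []; _∷_; length; _++_)
open import Data.List.Membership.Propositional using (_∈_)
open import Data.List.Membership.Propositional.Properties
  using (∈-++⁺ˡ; ∈-++⁺ʳ; ∈-++⁻; ∈-allFin; ∈-cartesianProductWith⁺; ∈-map⁺; ∈-map⁻; ∈-tabulate⁺; ∈-tabulate⁻)
import Data.List.Properties as Listₚ
open import Data.List.Relation.Binary.Pointwise using (Pointwise; []; _∷_)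
open import Data.List.Relation.Unary.All as All using (All; []; _∷_)
import Data.List.Relation.Unary.All.Properties as Allₚ
open import Data.List.Relation.Unary.Any using (here; there)
open import Data.Maybe using (just; maybe)
open import Data.Nat as ℕ using (ℕ; zero; suc; _≤_; _<_; z≤n; s≤s)
open import Data.Nat.Induction using (<-rec)
import Data.Nat.Properties as ℕₚ
open import Data.Product using (Σ; ∃; _×_; _,_; proj₁; proj₂)
open import Data.Sum as Sum using (_⊎_; inj₁; inj₂; [_,_]′)
open import Data.Unit using (⊤; tt)
open import Data.Vec as Vec using (Vec; []; _∷_; map; zipWith; replicate)
import Data.Vec.Properties as Vecₚ
open import Function using (_∘_; id; _∋_)
open import Function.Bundles using (Inverse; _↔_; mk↔ₛ′)
open import Relation.Binary.PropositionalEquality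
  using (_≡_; _≢_; refl; sym; trans; cong; cong₂; subst; module ≡-Reasoning)
open import Relation.Nullary using (¬_; Dec; yes; no; contradiction)
open import Relation.Nullary.Decidable
  using (⌊_⌋; True; toWitness; ¬?; _×-dec_; _⊎-dec_; _→-dec_; map′; decidable-stable)
open import Relation.Unary using (Decidable; _≐_)

-- Arithmetic of GF(2) and GF(3).

1F : (F : Field) → Fq F
1F GF2 = Fin.suc Fin.zero
1F GF3 = Fin.suc Fin.zero

-1F : (F : Field) → Fq F
-1F GF2 = Fin.suc Fin.zero
-1F GF3 = Fin.suc (Fin.suc Fin.zero)

infix 4 _≟_
_≟_ : {n : ℕ} → (x y : Fin n) → Dec (x ≡ y)
_≟_ = Finₚ._≟_

-- Scalar identities hold by evaluation at every element of both fields. The implicit `True`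
-- arguments are discharged by that computation.
law₁ : (f g : ∀ F → Fq F → Fq F) →
  {True (Finₚ.all? λ x → f GF2 x ≟ g GF2 x)} →
  {True (Finₚ.all? λ x → f GF3 x ≟ g GF3 x)} →
  ∀ F x → f F x ≡ g F x
law₁ f g {p} GF2 = toWitness p
law₁ f g {_} {p} GF3 = toWitness p

law₂ : (f g : ∀ F → Fq F → Fq F → Fq F) →
  {True (Finₚ.all? λ x → Finₚ.all? λ y → f GF2 x y ≟ g GF2 x y)} →
  {True (Finₚ.all? λ x → Finₚ.all? λ y → f GF3 x y ≟ g GF3 x y)} →
  ∀ F x y → f F x y ≡ g F x y
law₂ f g {p} GF2 = toWitness p
law₂ f g {_} {p} GF3 = toWitness p

law₃ : (f g : ∀ F → Fq F → Fq F → Fq F → Fq F) →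
  {True (Finₚ.all? λ x → Finₚ.all? λ y → Finₚ.all? λ z → f GF2 x y z ≟ g GF2 x y z)} →
  {True (Finₚ.all? λ x → Finₚ.all? λ y → Finₚ.all? λ z → f GF3 x y z ≟ g GF3 x y z)} →
  ∀ F x y z → f F x y z ≡ g F x y z
law₃ f g {p} GF2 = toWitness p
law₃ f g {_} {p} GF3 = toWitness p

+ᶠ-assoc : ∀ F x y z → addF F (addF F x y) z ≡ addF F x (addF F y z)
+ᶠ-assoc = law₃ _ _

+ᶠ-comm : ∀ F x y → addF F x y ≡ addF F y x
+ᶠ-comm = law₂ _ _

+ᶠ-identityˡ : ∀ F x → addF F (0F F) x ≡ x
+ᶠ-identityˡ = law₁ _ _

·-assoc : ∀ F x y z → mulF F (mulF F x y) z ≡ mulF F x (mulF F y z)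
·-assoc = law₃ _ _

·-comm : ∀ F x y → mulF F x y ≡ mulF F y x
·-comm = law₂ _ _

·-distribˡ : ∀ F x y z → mulF F x (addF F y z) ≡ addF F (mulF F x y) (mulF F x z)
·-distribˡ = law₃ _ _

·-distribʳ : ∀ F x y z → mulF F (addF F x y) z ≡ addF F (mulF F x z) (mulF F y z)
·-distribʳ = law₃ _ _

·-identityˡ : ∀ F x → mulF F (1F F) x ≡ x
·-identityˡ = law₁ _ _

·-zeroˡ : ∀ F x → mulF F (0F F) x ≡ 0F F
·-zeroˡ = law₁ _ _

·-zeroʳ : ∀ F x → mulF F x (0F F) ≡ 0F F
·-zeroʳ = law₁ _ _

+ᶠ-inverseʳ : ∀ F x → addF F x (mulF F (-1F F) x) ≡ 0F F
+ᶠ-inverseʳ = law₁ _ _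

-- This makes every nonzero scalar its own inverse, so no inverse operation is defined.
·-square : ∀ F x → x ≢ 0F F → mulF F x x ≡ 1F F
·-square GF2 = toWitness {a? = Finₚ.all? λ x → ¬? (x ≟ 0F GF2) →-dec (mulF GF2 x x ≟ 1F GF2)} tt
·-square GF3 = toWitness {a? = Finₚ.all? λ x → ¬? (x ≟ 0F GF3) →-dec (mulF GF3 x x ≟ 1F GF3)} tt

1≢0 : ∀ F → 1F F ≢ 0F F
1≢0 GF2 ()
1≢0 GF3 ()

-- Vectors, subspaces and linear maps over GF(q).

module Linear (F : Field) where

  𝔽 : Set
  𝔽 = Fq F

  V : ℕ → Set
  V k = Vec 𝔽 k

  infixl 6 _+ᶠ_
  infixl 7 _·_
  infixl 6 _⊕_
  infixr 7 _⊙_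

  _+ᶠ_ _·_ : 𝔽 → 𝔽 → 𝔽
  _+ᶠ_ = addF F
  _·_ = mulF F

  0ᶠ 1ᶠ -1ᶠ : 𝔽
  0ᶠ = 0F F
  1ᶠ = 1F F
  -1ᶠ = -1F F

  _⊕_ : ∀ {k} → V k → V k → V k
  _⊕_ = zipWith _+ᶠ_

  _⊙_ : ∀ {k} → 𝔽 → V k → V k
  c ⊙ v = map (c ·_) v

  𝟘 : ∀ {k} → V k
  𝟘 = zeroV F _

  infix 4 _≟ᵛ_
  _≟ᵛ_ : ∀ {k} → (u v : V k) → Dec (u ≡ v)
  _≟ᵛ_ = Vecₚ.≡-dec _≟_

  ·-cancel-square : ∀ {c} d → c ≢ 0ᶠ → c · (c · d) ≡ d
  ·-cancel-square {c} d c≢0 =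
    trans (sym (·-assoc F c c d)) (trans (cong (_· d) (·-square F c c≢0)) (·-identityˡ F d))

  ·-nonzero : ∀ {c d} → c ≢ 0ᶠ → d ≢ 0ᶠ → c · d ≢ 0ᶠ
  ·-nonzero {c} {d} c≢0 d≢0 cd≡0 =
    d≢0 (trans (sym (·-cancel-square d c≢0)) (trans (cong (c ·_) cd≡0) (·-zeroʳ F c)))

  -1≢0 : -1ᶠ ≢ 0ᶠ
  -1≢0 = go F
    where
    go : ∀ F → -1F F ≢ 0F F
    go GF2 ()
    go GF3 ()

  ⊕-assoc : ∀ {k} (u v w : V k) → (u ⊕ v) ⊕ w ≡ u ⊕ (v ⊕ w)
  ⊕-assoc = Vecₚ.zipWith-assoc (+ᶠ-assoc F)

  ⊕-comm : ∀ {k} (u v : V k) → u ⊕ v ≡ v ⊕ u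
  ⊕-comm = Vecₚ.zipWith-comm (+ᶠ-comm F)

  ⊕-identityˡ : ∀ {k} (v : V k) → 𝟘 ⊕ v ≡ v
  ⊕-identityˡ = Vecₚ.zipWith-identityˡ (+ᶠ-identityˡ F)

  ⊕-identityʳ : ∀ {k} (v : V k) → v ⊕ 𝟘 ≡ v
  ⊕-identityʳ v = trans (⊕-comm v 𝟘) (⊕-identityˡ v)

  ⊕-interchange : ∀ {k} (a b c d : V k) → (a ⊕ b) ⊕ (c ⊕ d) ≡ (a ⊕ c) ⊕ (b ⊕ d)
  ⊕-interchange a b c d = begin
    (a ⊕ b) ⊕ (c ⊕ d) ≡⟨ ⊕-assoc a b (c ⊕ d) ⟩
    a ⊕ (b ⊕ (c ⊕ d)) ≡⟨ cong (a ⊕_) (sym (⊕-assoc b c d)) ⟩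
    a ⊕ ((b ⊕ c) ⊕ d) ≡⟨ cong (λ t → a ⊕ (t ⊕ d)) (⊕-comm b c) ⟩
    a ⊕ ((c ⊕ b) ⊕ d) ≡⟨ cong (a ⊕_) (⊕-assoc c b d) ⟩
    a ⊕ (c ⊕ (b ⊕ d)) ≡⟨ sym (⊕-assoc a c (b ⊕ d)) ⟩
    (a ⊕ c) ⊕ (b ⊕ d) ∎
    where open ≡-Reasoning

  ⊙-distribˡ : ∀ {k} c (u v : V k) → c ⊙ (u ⊕ v) ≡ c ⊙ u ⊕ c ⊙ v
  ⊙-distribˡ c [] [] = refl
  ⊙-distribˡ c (x ∷ u) (y ∷ v) = cong₂ _∷_ (·-distribˡ F c x y) (⊙-distribˡ c u v)

  ⊙-distribʳ : ∀ {k} c d (v : V k) → (c +ᶠ d) ⊙ v ≡ c ⊙ v ⊕ d ⊙ v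
  ⊙-distribʳ c d [] = refl
  ⊙-distribʳ c d (x ∷ v) = cong₂ _∷_ (·-distribʳ F c d x) (⊙-distribʳ c d v)

  ⊙-assoc : ∀ {k} c d (v : V k) → c ⊙ d ⊙ v ≡ (c · d) ⊙ v
  ⊙-assoc c d [] = refl
  ⊙-assoc c d (x ∷ v) = cong₂ _∷_ (sym (·-assoc F c d x)) (⊙-assoc c d v)

  ⊙-identity : ∀ {k} (v : V k) → 1ᶠ ⊙ v ≡ v
  ⊙-identity [] = refl
  ⊙-identity (x ∷ v) = cong₂ _∷_ (·-identityˡ F x) (⊙-identity v)

  ⊙-zeroˡ : ∀ {k} (v : V k) → 0ᶠ ⊙ v ≡ 𝟘
  ⊙-zeroˡ [] = refl
  ⊙-zeroˡ (x ∷ v) = cong₂ _∷_ (·-zeroˡ F x) (⊙-zeroˡ v)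

  ⊙-zeroʳ : ∀ {k} c → c ⊙ 𝟘 {k} ≡ 𝟘
  ⊙-zeroʳ {zero} c = refl
  ⊙-zeroʳ {suc k} c = cong₂ _∷_ (·-zeroʳ F c) (⊙-zeroʳ c)

  ⊙-comm : ∀ {k} c d (v : V k) → c ⊙ d ⊙ v ≡ d ⊙ c ⊙ v
  ⊙-comm c d v = trans (⊙-assoc c d v) (trans (cong (_⊙ v) (·-comm F c d)) (sym (⊙-assoc d c v)))

  ⊕-inverseʳ : ∀ {k} (v : V k) → v ⊕ -1ᶠ ⊙ v ≡ 𝟘
  ⊕-inverseʳ [] = refl
  ⊕-inverseʳ (x ∷ v) = cong₂ _∷_ (+ᶠ-inverseʳ F x) (⊕-inverseʳ v)

  ⊙-involutive : ∀ {k c} (v : V k) → c ≢ 0ᶠ → c ⊙ c ⊙ v ≡ v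
  ⊙-involutive [] c≢0 = refl
  ⊙-involutive (x ∷ v) c≢0 = cong₂ _∷_ (·-cancel-square x c≢0) (⊙-involutive v c≢0)

  ⊙-nonzero : ∀ {k c} {v : V k} → c ≢ 0ᶠ → v ≢ 𝟘 → c ⊙ v ≢ 𝟘
  ⊙-nonzero {c = c} {v} c≢0 v≢0 cv≡0 =
    v≢0 (trans (sym (⊙-involutive v c≢0)) (trans (cong (c ⊙_) cv≡0) (⊙-zeroʳ c)))

  ⊕-cancelʳ : ∀ {k} (u v : V k) → (u ⊕ v) ⊕ -1ᶠ ⊙ v ≡ u
  ⊕-cancelʳ u v = trans (⊕-assoc u v _) (trans (cong (u ⊕_) (⊕-inverseʳ v)) (⊕-identityʳ u))

  ⊖-cancelʳ : ∀ {k} (u v : V k) → (u ⊕ -1ᶠ ⊙ v) ⊕ v ≡ u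
  ⊖-cancelʳ u v = trans (⊕-assoc u _ v)
    (trans (cong (u ⊕_) (trans (⊕-comm _ v) (⊕-inverseʳ v))) (⊕-identityʳ u))

  ⊖≡0⇒≡ : ∀ {k} {u v : V k} → u ⊕ -1ᶠ ⊙ v ≡ 𝟘 → u ≡ v
  ⊖≡0⇒≡ {u = u} {v} eq = trans (sym (⊖-cancelʳ u v)) (trans (cong (_⊕ v) eq) (⊕-identityˡ v))

  -- A nonzero scalar is its own inverse, so multiplying the relation by `c` once more solves it for
  -- `u`.
  isolate : ∀ {k c} {u v w : V k} → c ≢ 0ᶠ → c ⊙ u ⊕ v ≡ w → u ≡ c ⊙ w ⊕ (c · -1ᶠ) ⊙ v
  isolate {c = c} {u} {v} c≢0 refl = sym (begin
    c ⊙ (c ⊙ u ⊕ v) ⊕ (c · -1ᶠ) ⊙ v  ≡⟨ cong (c ⊙ (c ⊙ u ⊕ v) ⊕_) (sym (⊙-assoc c -1ᶠ v)) ⟩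
    c ⊙ (c ⊙ u ⊕ v) ⊕ c ⊙ -1ᶠ ⊙ v    ≡⟨ sym (⊙-distribˡ c _ _) ⟩
    c ⊙ ((c ⊙ u ⊕ v) ⊕ -1ᶠ ⊙ v)      ≡⟨ cong (c ⊙_) (⊕-cancelʳ _ v) ⟩
    c ⊙ c ⊙ u                        ≡⟨ ⊙-involutive u c≢0 ⟩
    u ∎)
    where open ≡-Reasoning

  -- Search over finitely many vectors. It replaces excluded middle in the case distinctions on
  -- vectors below.
  ∃ᵛ? : ∀ {k} {P : V k → Set} → Decidable P → Dec (∃ P)
  ∃ᵛ? {zero} P? = map′ (λ p → [] , p) (λ { ([] , p) → p }) (P? [])
  ∃ᵛ? {suc k} P? = map′ (λ { (x , v , p) → x ∷ v , p }) (λ { (x ∷ v , p) → x , v , p })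
    (Finₚ.any? λ x → ∃ᵛ? λ v → P? (x ∷ v))

  record Subspace {k} (S : V k → Set) : Set where
    field
      zero∈ : S 𝟘
      add∈ : ∀ {u v} → S u → S v → S (u ⊕ v)
      scale∈ : ∀ c {v} → S v → S (c ⊙ v)

    sub∈ : ∀ {u v} → S (u ⊕ v) → S v → S u
    sub∈ {u} {v} uv sv = subst S (⊕-cancelʳ u v) (add∈ uv (scale∈ -1ᶠ sv))

    unscale∈ : ∀ {c v} → c ≢ 0ᶠ → S (c ⊙ v) → S v
    unscale∈ {c} {v} c≢0 scv = subst S (⊙-involutive v c≢0) (scale∈ c scv)

  open Subspace public

  record Linear {m n} (φ : V m → V n) : Set where
    field
      +-homo : ∀ u v → φ (u ⊕ v) ≡ φ u ⊕ φ v
      ⊙-homo : ∀ c v → φ (c ⊙ v) ≡ c ⊙ φ v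

    0-homo : φ 𝟘 ≡ 𝟘
    0-homo = trans (cong φ (sym (⊙-zeroˡ 𝟘))) (trans (⊙-homo 0ᶠ 𝟘) (⊙-zeroˡ _))

    preimage-subspace : ∀ {S} → Subspace S → Subspace (λ u → S (φ u))
    preimage-subspace {S} sub .zero∈ = subst S (sym 0-homo) (zero∈ sub)
    preimage-subspace {S} sub .add∈ {u} {v} p q = subst S (sym (+-homo u v)) (add∈ sub p q)
    preimage-subspace {S} sub .scale∈ c {v} p = subst S (sym (⊙-homo c v)) (scale∈ sub c p)

    image-subspace : ∀ {S} → Subspace S → Subspace (λ v → ∃ λ u → S u × φ u ≡ v)
    image-subspace sub .zero∈ = 𝟘 , zero∈ sub , 0-homo
    image-subspace sub .add∈ (u , p , refl) (v , q , refl) = u ⊕ v , add∈ sub p q , +-homo u v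
    image-subspace sub .scale∈ c (u , p , refl) = c ⊙ u , scale∈ sub c p , ⊙-homo c u

  open Linear public

  TrivialKernel : ∀ {m n} → (V m → V n) → Set
  TrivialKernel φ = ∀ u → φ u ≡ 𝟘 → u ≡ 𝟘

  injective : ∀ {m n} {φ : V m → V n} → Linear φ → TrivialKernel φ → ∀ {u v} → φ u ≡ φ v → u ≡ v
  injective {φ = φ} lin ker {u} {v} eq = ⊖≡0⇒≡ (ker _ (begin
    φ (u ⊕ -1ᶠ ⊙ v)      ≡⟨ +-homo lin u _ ⟩
    φ u ⊕ φ (-1ᶠ ⊙ v)    ≡⟨ cong₂ _⊕_ eq (⊙-homo lin -1ᶠ v) ⟩
    φ v ⊕ -1ᶠ ⊙ φ v      ≡⟨ ⊕-inverseʳ (φ v) ⟩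
    𝟘 ∎))
    where open ≡-Reasoning

  id-linear : ∀ {k} → Linear {k} id
  id-linear .+-homo _ _ = refl
  id-linear .⊙-homo _ _ = refl

  -- Spans, independence and bases.

  data Span {k} (P : V k → Set) : V k → Set where
    span-zero : Span P 𝟘
    span-step : ∀ c {v w} → P v → Span P w → Span P (c ⊙ v ⊕ w)

  Span-least : ∀ {k} {P S : V k → Set} → Subspace S → (∀ {v} → P v → S v) → ∀ {v} → Span P v → S v
  Span-least sub P⊆S span-zero = zero∈ sub
  Span-least sub P⊆S (span-step c p s) = add∈ sub (scale∈ sub c (P⊆S p)) (Span-least sub P⊆S s)

  Span-subspace : ∀ {k} {P : V k → Set} → Subspace (Span P)
  Span-subspace .zero∈ = span-zero
  Span-subspace {P = P} .add∈ {v = v} span-zero q = subst (Span P) (sym (⊕-identityˡ v)) q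
  Span-subspace {P = P} .add∈ {v = v} (span-step c p s) q =
    subst (Span P) (sym (⊕-assoc _ _ v)) (span-step c p (Span-subspace .add∈ s q))
  Span-subspace {P = P} .scale∈ c span-zero = subst (Span P) (sym (⊙-zeroʳ c)) span-zero
  Span-subspace {P = P} .scale∈ c (span-step d {v} {w} p s) =
    subst (Span P) (sym (trans (⊙-distribˡ c _ w) (cong (_⊕ c ⊙ w) (⊙-assoc c d v))))
      (span-step (c · d) p (Span-subspace .scale∈ c s))

  ⊆Span : ∀ {k} {P : V k → Set} {v} → P v → Span P v
  ⊆Span {P = P} {v} p =
    subst (Span P) (trans (⊕-identityʳ _) (⊙-identity v)) (span-step 1ᶠ p span-zero)

  Span-mono : ∀ {k} {P Q : V k → Set} → (∀ {v} → P v → Q v) → ∀ {v} → Span P v → Span Q v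
  Span-mono P⊆Q = Span-least Span-subspace (λ p → ⊆Span (P⊆Q p))

  comb′ : ∀ {k} (bs : List (V k)) → V (length bs) → V k
  comb′ [] [] = 𝟘
  comb′ (b ∷ bs) (c ∷ cs) = c ⊙ b ⊕ comb′ bs cs

  comb′-linear : ∀ {k} (bs : List (V k)) → Linear (comb′ bs)
  comb′-linear [] .+-homo [] [] = sym (⊕-identityˡ 𝟘)
  comb′-linear [] .⊙-homo c [] = sym (⊙-zeroʳ c)
  comb′-linear (b ∷ bs) .+-homo (c ∷ cs) (d ∷ ds) = trans
    (cong₂ _⊕_ (⊙-distribʳ c d b) (comb′-linear bs .+-homo cs ds)) (⊕-interchange _ _ _ _)
  comb′-linear (b ∷ bs) .⊙-homo c (d ∷ ds) = trans
    (cong₂ _⊕_ (sym (⊙-assoc c d b)) (comb′-linear bs .⊙-homo c ds)) (sym (⊙-distribˡ c _ _))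

  -- `Span` serves sets given by a property; `SpanL` serves lists, whose lengths count dimensions.
  record SpanL {k} (bs : List (V k)) (v : V k) : Set where
    constructor combo
    field
      coeffs : V (length bs)
      comb≡ : comb′ bs coeffs ≡ v

  open SpanL public

  SpanL? : ∀ {k} (bs : List (V k)) → Decidable (SpanL bs)
  SpanL? bs v = map′ (λ { (cs , eq) → combo cs eq }) (λ { (combo cs eq) → cs , eq })
    (∃ᵛ? λ cs → comb′ bs cs ≟ᵛ v)

  SpanL-subspace : ∀ {k} {bs : List (V k)} → Subspace (SpanL bs)
  SpanL-subspace {bs = bs} .zero∈ = combo 𝟘 (0-homo (comb′-linear bs))
  SpanL-subspace {bs = bs} .add∈ (combo cs refl) (combo ds refl) =
    combo (cs ⊕ ds) (+-homo (comb′-linear bs) cs ds)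
  SpanL-subspace {bs = bs} .scale∈ c (combo cs refl) = combo (c ⊙ cs) (⊙-homo (comb′-linear bs) c cs)

  SpanL-least : ∀ {k} {S : V k → Set} {bs} → Subspace S → All S bs → ∀ {v} → SpanL bs v → S v
  SpanL-least sub [] (combo [] refl) = zero∈ sub
  SpanL-least sub (p ∷ ps) (combo (c ∷ cs) refl) =
    add∈ sub (scale∈ sub c p) (SpanL-least sub ps (combo cs refl))

  drop-zero : ∀ {k} (u v : V k) → 0ᶠ ⊙ u ⊕ v ≡ v
  drop-zero u v = trans (cong (_⊕ v) (⊙-zeroˡ u)) (⊕-identityˡ v)

  SpanL-there : ∀ {k} {b : V k} {bs v} → SpanL bs v → SpanL (b ∷ bs) v
  SpanL-there {b = b} {bs} (combo cs refl) =
    combo (0ᶠ ∷ cs) (drop-zero b (comb′ bs cs))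

  ∈⇒SpanL : ∀ {k} {bs : List (V k)} {v} → v ∈ bs → SpanL bs v
  ∈⇒SpanL {bs = b ∷ bs} (here refl) = combo (1ᶠ ∷ 𝟘)
    (trans (cong₂ _⊕_ (⊙-identity b) (0-homo (comb′-linear bs))) (⊕-identityʳ b))
  ∈⇒SpanL (there v∈bs) = SpanL-there (∈⇒SpanL v∈bs)

  SpanL-mono : ∀ {k} {as bs : List (V k)} → (∀ {v} → v ∈ as → v ∈ bs) → ∀ {v} → SpanL as v → SpanL bs v
  SpanL-mono {as = as} as⊆bs = SpanL-least {bs = as} SpanL-subspace (All.tabulate λ a∈ → ∈⇒SpanL (as⊆bs a∈))

  -- A recursive form of linear independence, suited to building bases one vector at a time. It is
  -- shown equivalent to `LinInd` later.
  Indep : ∀ {k} → List (V k) → Set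
  Indep [] = ⊤
  Indep (b ∷ bs) = ¬ SpanL bs b × Indep bs

  comb′-injective : ∀ {k} {bs : List (V k)} → Indep bs → TrivialKernel (comb′ bs)
  comb′-injective {bs = []} _ [] _ = refl
  comb′-injective {bs = b ∷ bs} (b∉ , ind) (c ∷ cs) eq with c ≟ 0ᶠ
  ... | yes refl = cong (0ᶠ ∷_) (comb′-injective ind cs
        (trans (sym (drop-zero b (comb′ bs cs))) eq))
  ... | no c≢0 = contradiction
        (subst (SpanL bs) (sym (isolate c≢0 eq))
          (add∈ SpanL-subspace (scale∈ SpanL-subspace c (zero∈ SpanL-subspace))
            (scale∈ SpanL-subspace (c · -1ᶠ) (combo cs refl))))
        b∉

  private
    -- As `y` is outside the span of `ys`, some vector of `xs` occurs in it with nonzero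
    -- coefficient. The first such vector is traded for `y`.
    exchange : ∀ {k} (xs ys : List (V k)) {y} → SpanL (xs ++ ys) y → ¬ SpanL ys y →
      ∃ λ xs′ → suc (length xs′) ≡ length xs ×
        (∀ {v} → SpanL (xs ++ ys) v → SpanL (xs′ ++ y ∷ ys) v)
    exchange [] ys y∈ y∉ = contradiction y∈ y∉
    exchange (x ∷ xs) ys {y} (combo (c ∷ cs) eq) y∉ with c ≟ 0ᶠ
    ... | yes refl with exchange xs ys
            (combo cs (trans (sym (drop-zero x (comb′ (xs ++ ys) cs))) eq)) y∉
    ...   | xs′ , len , covers = x ∷ xs′ , cong suc len ,
            SpanL-least SpanL-subspace (∈⇒SpanL (here refl) ∷
              All.tabulate (λ v∈ → SpanL-there (covers (∈⇒SpanL v∈))))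
    exchange (x ∷ xs) ys {y} (combo (c ∷ cs) eq) y∉ | no c≢0 = xs , refl ,
      SpanL-least SpanL-subspace
        (subst (SpanL (xs ++ y ∷ ys)) (sym (isolate c≢0 eq))
          (add∈ SpanL-subspace
            (scale∈ SpanL-subspace c (∈⇒SpanL (∈-++⁺ʳ xs (here refl))))
            (scale∈ SpanL-subspace (c · -1ᶠ) (SpanL-mono weaken (combo cs refl))))
        ∷ All.tabulate (λ v∈ → ∈⇒SpanL (weaken v∈)))
      where
      weaken : ∀ {v} → v ∈ xs ++ ys → v ∈ xs ++ y ∷ ys
      weaken v∈ with ∈-++⁻ xs v∈
      ... | inj₁ p = ∈-++⁺ˡ p
      ... | inj₂ p = ∈-++⁺ʳ xs (there p)

    -- The vectors of `ys` enter one at a time, each displacing exactly one vector of `xs`.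
    steinitz-extend : ∀ {k} (xs : List (V k)) {ys} → Indep ys → All (SpanL xs) ys →
      ∃ λ xs′ → length xs′ ℕ.+ length ys ≡ length xs × (∀ {v} → SpanL xs v → SpanL (xs′ ++ ys) v)
    steinitz-extend xs {[]} _ _ = xs , ℕₚ.+-identityʳ _ ,
      SpanL-mono ∈-++⁺ˡ
    steinitz-extend xs {y ∷ ys} (y∉ , ind) (y∈ ∷ ys⊆) with steinitz-extend xs ind ys⊆
    ... | xs₁ , len₁ , covers₁ with exchange xs₁ ys (covers₁ y∈) y∉
    ... | xs₂ , len₂ , covers₂ = xs₂ ,
      trans (ℕₚ.+-suc _ _) (trans (cong (ℕ._+ length ys) len₂) len₁) ,
      λ p → covers₂ (covers₁ p)

  steinitz : ∀ {k} {xs ys : List (V k)} → Indep ys → All (SpanL xs) ys → length ys ≤ length xs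
  steinitz {xs = xs} {ys} ind ys⊆ with steinitz-extend xs ind ys⊆
  ... | xs′ , len , _ = subst (length ys ≤_) len (ℕₚ.m≤n+m (length ys) (length xs′))

  -- A vector of the span of `xs` outside the span of `ys` would extend `ys` to an independent list
  -- longer than `xs`.
  steinitz-spans : ∀ {k} {xs ys : List (V k)} → Indep ys → All (SpanL xs) ys →
    length xs ≤ length ys → ∀ {v} → SpanL xs v → SpanL ys v
  steinitz-spans {xs = xs} {ys} ind ys⊆ le {v} v∈ with SpanL? ys v
  ... | yes p = p
  ... | no v∉ = contradiction (ℕₚ.≤-trans (steinitz (v∉ , ind) (v∈ ∷ ys⊆)) le) (ℕₚ.<-irrefl refl)

  unit : ∀ {k} → Fin k → V k
  unit Fin.zero = 1ᶠ ∷ 𝟘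
  unit (Fin.suc i) = 0ᶠ ∷ unit i

  -- A vector is a combination of the unit vectors on its support, so coordinates where it vanishes
  -- demand nothing of `S`.
  unit-induction : ∀ {k} {S : V k → Set} → Subspace S →
    ∀ v → (∀ i → Vec.lookup v i ≡ 0ᶠ ⊎ S (unit i)) → S v
  unit-induction sub [] h = zero∈ sub
  unit-induction {suc k} {S} sub (x ∷ v) h = subst S (split x v) (add∈ sub head∈ tail∈)
    where
    cons-linear : Linear (0ᶠ ∷_)
    cons-linear .+-homo u w = cong (_∷ (u ⊕ w)) (sym (+ᶠ-identityˡ F 0ᶠ))
    cons-linear .⊙-homo c w = cong (_∷ (c ⊙ w)) (sym (·-zeroʳ F c))
    tail∈ : S (0ᶠ ∷ v)
    tail∈ = unit-induction (preimage-subspace cons-linear sub) v (λ i → h (Fin.suc i))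
    head∈ : S (x ⊙ unit Fin.zero)
    head∈ with h Fin.zero
    ... | inj₁ refl = subst S (sym (⊙-zeroˡ _)) (zero∈ sub)
    ... | inj₂ s = scale∈ sub x s
    split : ∀ x v → x ⊙ unit Fin.zero ⊕ (0ᶠ ∷ v) ≡ x ∷ v
    split x v = cong₂ _∷_
      (trans (+ᶠ-comm F _ 0ᶠ) (trans (+ᶠ-identityˡ F _) (trans (·-comm F x 1ᶠ) (·-identityˡ F x))))
      (trans (cong (_⊕ v) (⊙-zeroʳ x)) (⊕-identityˡ v))

  Indep-length : ∀ {k} {ys : List (V k)} → Indep ys → length ys ≤ k
  Indep-length {k} {ys} ind = subst (length ys ≤_) (Listₚ.length-tabulate unit)
    (steinitz ind (All.tabulate λ {v} _ →
      unit-induction SpanL-subspace v (λ i → inj₂ (∈⇒SpanL (∈-tabulate⁺ i)))))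

  record Basis {k} (P : V k → Set) (bs : List (V k)) : Set where
    constructor basis
    field
      inside : All P bs
      indep : Indep bs
      spans : ∀ {v} → P v → SpanL bs v

  open Basis public

  Span⇒SpanL : ∀ {k} {P : V k → Set} {bs} → Basis P bs → ∀ {v} → Span P v → SpanL bs v
  Span⇒SpanL B = Span-least SpanL-subspace (spans B)

  SpanL⇒Span : ∀ {k} {P : V k → Set} {bs} → All P bs → ∀ {v} → SpanL bs v → Span P v
  SpanL⇒Span bs⊆P = SpanL-least Span-subspace (All.map ⊆Span bs⊆P)

  -- Greedy extension. The fuel is `k` minus the current length; an independent list has at most `k`
  -- members, so none can be added once the fuel is spent.
  ∃basis : ∀ {k} {P : V k → Set} → Decidable P → ∃ (Basis P)
  ∃basis {k} {P} P? = extend k [] refl [] tt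
    where
    extend : ∀ fuel (bs : List (V k)) → length bs ℕ.+ fuel ≡ k → All P bs → Indep bs → ∃ (Basis P)
    extend fuel bs len bs⊆P ind with ∃ᵛ? (λ v → P? v ×-dec ¬? (SpanL? bs v))
    ... | no ∄v = bs , basis bs⊆P ind
          (λ {v} p → decidable-stable (SpanL? bs v) (λ v∉ → ∄v (v , p , v∉)))
    extend zero bs len bs⊆P ind | yes (v , p , v∉) =
      contradiction (subst (suc (length bs) ≤_) (sym (trans (sym (ℕₚ.+-identityʳ _)) len))
        (Indep-length (v∉ , ind))) (ℕₚ.<-irrefl refl)
    extend (suc fuel) bs len bs⊆P ind | yes (v , p , v∉) =
      extend fuel (v ∷ bs) (trans (sym (ℕₚ.+-suc _ fuel)) len) (p ∷ bs⊆P) (v∉ , ind)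

  comb-toList : ∀ {k} (bs : List (V k)) (cs : V (length bs)) →
    comb F (List.zip (Vec.toList cs) bs) ≡ comb′ bs cs
  comb-toList [] [] = refl
  comb-toList (b ∷ bs) (c ∷ cs) = cong (c ⊙ b ⊕_) (comb-toList bs cs)

  fromList′ : ∀ {k} (bs : List (V k)) (cs : List 𝔽) → length cs ≡ length bs →
    ∃ λ (cs′ : V (length bs)) → Vec.toList cs′ ≡ cs
  fromList′ [] [] _ = [] , refl
  fromList′ (_ ∷ bs) (c ∷ cs) len with fromList′ bs cs (ℕₚ.suc-injective len)
  ... | cs′ , eq = c ∷ cs′ , cong (c ∷_) eq

-- Transport of bases and separations along injective linear maps.

module Colourings (F : Field) where

  open Linear F

  LinInd⇒Indep : ∀ {k} (bs : List (V k)) → LinInd F bs → Indep bs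
  LinInd⇒Indep [] _ = tt
  LinInd⇒Indep (b ∷ bs) ind = b∉ , LinInd⇒Indep bs tail-ind
    where
    b∉ : ¬ SpanL bs b
    b∉ (combo cs eq) = -1≢0 (All.head (ind (-1ᶠ ∷ Vec.toList cs) (cong suc (Vecₚ.length-toList cs))
      (trans (cong (-1ᶠ ⊙ b ⊕_) (trans (comb-toList bs cs) eq))
        (trans (⊕-comm _ b) (⊕-inverseʳ b)))))
    tail-ind : LinInd F bs
    tail-ind cs len eq =
      All.tail (ind (0ᶠ ∷ cs) (cong suc len) (trans (drop-zero b _) eq))

  Indep⇒LinInd : ∀ {k} (bs : List (V k)) → Indep bs → LinInd F bs
  Indep⇒LinInd bs ind cs len eq with fromList′ bs cs len
  ... | cs′ , refl = subst (λ v → All (_≡ 0ᶠ) (Vec.toList v))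
        (sym (comb′-injective ind cs′ (trans (sym (comb-toList bs cs′)) eq)))
        (zeros (length bs))
    where
    zeros : ∀ n → All (_≡ 0ᶠ) (Vec.toList (𝟘 {n}))
    zeros zero = []
    zeros (suc n) = refl ∷ zeros n

  -- Points are vectors up to scalars, so images are compared up to a nonzero factor in each entry.
  ScaledImage : ∀ {m n} → (V m → V n) → List (V m) → List (V n) → Set
  ScaledImage φ = Pointwise λ a b → ∃ λ c → c ≢ 0ᶠ × b ≡ c ⊙ φ a

  module _ {m n} {φ : V m → V n} (lin : Linear φ) where

    SpanL-push : ∀ {as bs} → ScaledImage φ as bs → ∀ {u} → SpanL as u → SpanL bs (φ u)
    SpanL-push {bs = bs} rel = SpanL-least (preimage-subspace lin SpanL-subspace) (go rel id)
      where
      go : ∀ {as′ bs′} → ScaledImage φ as′ bs′ → (∀ {v} → v ∈ bs′ → v ∈ bs) →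
        All (λ a → SpanL bs (φ a)) as′
      go [] _ = []
      go ((c , c≢0 , refl) ∷ rel) ⊆bs =
        unscale∈ SpanL-subspace c≢0 (∈⇒SpanL (⊆bs (here refl))) ∷ go rel (⊆bs ∘ there)

    SpanL-pull : ∀ {as bs} → ScaledImage φ as bs → ∀ {v} → SpanL bs v →
      ∃ λ u → SpanL as u × φ u ≡ v
    SpanL-pull {as} rel = SpanL-least (image-subspace lin SpanL-subspace) (go rel id)
      where
      go : ∀ {as′ bs′} → ScaledImage φ as′ bs′ → (∀ {v} → v ∈ as′ → v ∈ as) →
        All (λ b → ∃ λ u → SpanL as u × φ u ≡ b) bs′
      go [] _ = []
      go ((c , c≢0 , refl) ∷ rel) ⊆as =
        (c ⊙ _ , scale∈ SpanL-subspace c (∈⇒SpanL (⊆as (here refl))) , ⊙-homo lin c _)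
          ∷ go rel (⊆as ∘ there)

    module _ (ker : TrivialKernel φ) where

      Indep-push : ∀ {as bs} → ScaledImage φ as bs → Indep as → Indep bs
      Indep-push [] _ = tt
      Indep-push ((c , c≢0 , refl) ∷ rel) (a∉ , ind) = b∉ , Indep-push rel ind
        where
        b∉ : ¬ SpanL _ (c ⊙ φ _)
        b∉ s with SpanL-pull rel (unscale∈ SpanL-subspace c≢0 s)
        ... | u , u∈ , eq = a∉ (subst (SpanL _) (injective lin ker eq) u∈)

      Indep-pull : ∀ {as bs} → ScaledImage φ as bs → Indep bs → Indep as
      Indep-pull [] _ = tt
      Indep-pull (_∷_ {xs = as} {ys = bs} (c , c≢0 , refl) rel) (b∉ , ind) =
        (λ s → b∉ (scale∈ SpanL-subspace c (SpanL-push rel s))) , Indep-pull rel ind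

  -- `P` is the preimage of `Q`, and `Q` lies in the range of `φ`; hence `Q` is the image of `P`.
  record Image {m n} (φ : V m → V n) (P : V m → Set) (Q : V n → Set) : Set where
    field
      to : ∀ {u} → P u → Q (φ u)
      from : ∀ {u} → Q (φ u) → P u
      onto : ∀ {v} → Q v → ∃ λ u → φ u ≡ v

  SameRankᵛ : ∀ {k} → (P Q : V k → Set) → Set
  SameRankᵛ P Q = ∃ λ as → ∃ λ bs → Basis P as × Basis Q bs × length as ≡ length bs

  -- Two nonempty parts whose spans meet only in zero. This amounts to additivity of rank, but
  -- passes along linear maps without any counting.
  record Disc {k} (P : V k → Set) : Set₁ where
    field
      A : V k → Set
      A? : Decidable A
      A⊆ : ∀ {v} → A v → P v
      A-nonempty : ∃ A
      rest-nonempty : ∃ λ v → P v × ¬ A v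
      meet-trivial : ∀ {v} → Span A v → Span (λ v → P v × ¬ A v) v → v ≡ 𝟘

  module _ {m n} {φ : V m → V n} (lin : Linear φ) (ker : TrivialKernel φ)
           {P : V m → Set} {Q : V n → Set} (img : Image φ P Q) where

    open Image img

    Basis-push : ∀ {as} → Basis P as → ∃ λ bs → Basis Q bs × length as ≡ length bs
    Basis-push {as} B = List.map φ as ,
      basis (Allₚ.map⁺ (All.map to (inside B))) (Indep-push lin ker (rel as) (indep B)) spans′ ,
      sym (Listₚ.length-map φ as)
      where
      rel : ∀ as → ScaledImage φ as (List.map φ as)
      rel [] = []
      rel (a ∷ as) = (1ᶠ , 1≢0 F , sym (⊙-identity (φ a))) ∷ rel as
      spans′ : ∀ {v} → Q v → SpanL (List.map φ as) v
      spans′ q with onto q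
      ... | u , refl = SpanL-push lin (rel as) (spans B (from q))

    private
      preimages : ∀ {bs} → All Q bs → ∃ λ as → All P as × ScaledImage φ as bs × length as ≡ length bs
      preimages [] = [] , [] , [] , refl
      preimages (q ∷ qs) with onto q | preimages qs
      ... | u , refl | as , ps , rel , len =
        u ∷ as , from q ∷ ps , (1ᶠ , 1≢0 F , sym (⊙-identity (φ u))) ∷ rel , cong suc len

    Basis-pull : ∀ {bs} → Basis Q bs → ∃ λ as → Basis P as × length as ≡ length bs
    Basis-pull B with preimages (inside B)
    ... | as , ps , rel , len = as , basis ps (Indep-pull lin ker rel (indep B)) spans′ , len
      where
      spans′ : ∀ {u} → P u → SpanL as u
      spans′ p with SpanL-pull lin rel (spans B (to p))
      ... | u′ , u′∈ , eq = subst (SpanL as) (injective lin ker eq) u′∈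

    Disc-push : Disc P → Disc Q
    Disc-push D = record
      { A = λ v → ∃ λ u → A u × φ u ≡ v
      ; A? = λ v → ∃ᵛ? (λ u → A? u ×-dec (φ u ≟ᵛ v))
      ; A⊆ = λ { (u , a , refl) → to (A⊆ a) }
      ; A-nonempty = φ (proj₁ A-nonempty) , _ , proj₂ A-nonempty , refl
      ; rest-nonempty = rest
      ; meet-trivial = meet
      }
      where
      open Disc D
      rest : ∃ λ v → Q v × ¬ (∃ λ u → A u × φ u ≡ v)
      rest with rest-nonempty
      ... | u , p , ¬a = φ u , to p , λ { (u′ , a , eq) → ¬a (subst A (injective lin ker eq) a) }
      meet : ∀ {v} → Span (λ v → ∃ λ u → A u × φ u ≡ v) v →
        Span (λ v → Q v × ¬ (∃ λ u → A u × φ u ≡ v)) v → v ≡ 𝟘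
      meet s t
        with Span-least (image-subspace lin Span-subspace) (λ { (u , a , eq) → u , ⊆Span a , eq }) s
           | Span-least (image-subspace lin Span-subspace)
               (λ { (q , ¬a) → let u , eq = onto q in
                    u , ⊆Span (from (subst Q (sym eq) q) , λ a → ¬a (u , a , eq)) , eq }) t
      ... | u , u∈ , refl | u′ , u′∈ , eq =
        trans (cong φ (meet-trivial u∈ (subst (Span _) (injective lin ker eq) u′∈))) (0-homo lin)

    Disc-pull : Disc Q → Disc P
    Disc-pull D = record
      { A = A ∘ φ
      ; A? = A? ∘ φ
      ; A⊆ = from ∘ A⊆
      ; A-nonempty = nonempty
      ; rest-nonempty = rest
      ; meet-trivial = λ {u} s t → ker u (meet-trivial
          (Span-least (preimage-subspace lin Span-subspace) ⊆Span s)
          (Span-least (preimage-subspace lin Span-subspace) (λ (p , ¬a) → ⊆Span (to p , ¬a)) t))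
      }
      where
      open Disc D
      nonempty : ∃ λ u → A (φ u)
      nonempty with A-nonempty
      ... | v , a with onto (A⊆ a)
      ... | u , refl = u , a
      rest : ∃ λ u → P u × ¬ A (φ u)
      rest with rest-nonempty
      ... | v , q , ¬a with onto q
      ... | u , refl = u , from q , ¬a

  -- Good colourings: the flat condition stated for subspaces.

  Colouring : ℕ → Set
  Colouring k = V k → Bool

  -- The zero vector represents no point and is excluded, so its colour never matters.
  Mono : ∀ {k} → Colouring k → Bool → (V k → Set) → V k → Set
  Mono χ b W v = W v × v ≢ 𝟘 × χ v ≡ b

  Mono? : ∀ {k} (χ : Colouring k) b {W} → Decidable W → Decidable (Mono χ b W)
  Mono? χ b W? v = W? v ×-dec ¬? (v ≟ᵛ 𝟘) ×-dec (χ v ≟ᵇ b)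

  Goodᵂ : ∀ {k} → Colouring k → (V k → Set) → Set₁
  Goodᵂ χ W = SameRankᵛ (Mono χ true W) (Mono χ false W) →
    Disc (Mono χ true W) ⊎ Disc (Mono χ false W)

  -- The zero subspace is left out: there both colour classes are empty, of equal rank zero, and
  -- neither is disconnected.
  Good : ∀ {k} → Colouring k → Set₁
  Good χ = ∀ W → Decidable W → Subspace W → (∃ λ v → W v × v ≢ 𝟘) → Goodᵂ χ W

  module _ {m n} {φ : V m → V n} (lin : Linear φ) (ker : TrivialKernel φ)
           {χ′ : Colouring m} {χ : Colouring n} (agree : ∀ u → u ≢ 𝟘 → χ (φ u) ≡ χ′ u) where

    nonzero-push : ∀ {u} → u ≢ 𝟘 → φ u ≢ 𝟘
    nonzero-push u≢0 eq = u≢0 (ker _ eq)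

    nonzero-pull : ∀ {u} → φ u ≢ 𝟘 → u ≢ 𝟘
    nonzero-pull φu≢0 refl = φu≢0 (0-homo lin)

    -- The condition for `χ` is applied to the image of `W`: bases are pushed forward, and the
    -- separation found there is pulled back.
    Good-pull : Good χ → Good χ′
    Good-pull good W W? sub (w , w∈ , w≢0) (as , bs , A , B , len) =
      let as′ , A′ , len-as = Basis-push lin ker (img true) A
          bs′ , B′ , len-bs = Basis-push lin ker (img false) B
      in Sum.map (Disc-pull lin ker (img true)) (Disc-pull lin ker (img false))
        (good _ (λ v → ∃ᵛ? λ u → W? u ×-dec (φ u ≟ᵛ v)) (image-subspace lin sub)
          (φ w , (w , w∈ , refl) , nonzero-push w≢0)
          (as′ , bs′ , A′ , B′ , trans (sym len-as) (trans len len-bs)))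
      where
      img : ∀ b → Image φ (Mono χ′ b W) (Mono χ b (λ v → ∃ λ u → W u × φ u ≡ v))
      img b .Image.to {u} (u∈ , u≢0 , col) =
        (u , u∈ , refl) , nonzero-push u≢0 , trans (agree u u≢0) col
      img b .Image.from {u} ((u′ , u′∈ , eq) , φu≢0 , col) =
        subst W (injective lin ker eq) u′∈ , nonzero-pull φu≢0 ,
        trans (sym (agree u (nonzero-pull φu≢0))) col
      img b .Image.onto ((u , _ , eq) , _) = u , eq

    Goodᵂ-image : Good χ′ → ∀ {W} → Decidable W → Subspace W → (∃ λ v → W v × v ≢ 𝟘) →
      (∀ {v} → W v → ∃ λ u → φ u ≡ v) → Goodᵂ χ W
    Goodᵂ-image good {W} W? sub (w , w∈ , w≢0) W⊆im (as , bs , A , B , len) =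
      let as′ , A′ , len-as = Basis-pull lin ker (img true) A
          bs′ , B′ , len-bs = Basis-pull lin ker (img false) B
          u , eq = W⊆im w∈
      in Sum.map (Disc-push lin ker (img true)) (Disc-push lin ker (img false))
        (good _ (W? ∘ φ) (preimage-subspace lin sub)
          (u , subst W (sym eq) w∈ , nonzero-pull (w≢0 ∘ trans (sym eq)))
          (as′ , bs′ , A′ , B′ , trans len-as (trans len (sym len-bs))))
      where
      img : ∀ b → Image φ (Mono χ′ b (W ∘ φ)) (Mono χ b W)
      img b .Image.to {u} (u∈ , u≢0 , col) = u∈ , nonzero-push u≢0 , trans (agree u u≢0) col
      img b .Image.from {u} (u∈ , φu≢0 , col) =
        u∈ , nonzero-pull φu≢0 , trans (sym (agree u (nonzero-pull φu≢0))) col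
      img b .Image.onto (v∈ , _) = W⊆im v∈

    -- If W is not contained in the image of φ, then W minus the image spans W,
    -- while the colour class `true` does not.
    Goodᵂ-push : Good χ′ → ∀ {W} → Decidable W → Subspace W → (∃ λ v → W v × v ≢ 𝟘) →
      (∀ {v} → Mono χ true W v → ∃ λ u → φ u ≡ v) → Goodᵂ χ W
    Goodᵂ-push good {W} W? sub nz true⊆im same@(as , bs , A , B , len)
      with ∃ᵛ? (λ w → W? w ×-dec ¬? (∃ᵛ? λ u → φ u ≟ᵛ w))
    ... | no ∄w = Goodᵂ-image good W? sub nz
          (λ {v} v∈ → decidable-stable (∃ᵛ? λ u → φ u ≟ᵛ v) (λ v∉ → ∄w (v , v∈ , v∉))) same
    ... | yes (w , w∈ , w∉im) = contradiction (im-as (spans-as w∈)) w∉im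
      where
      Im : V n → Set
      Im v = ∃ λ u → φ u ≡ v
      Im-subspace : Subspace Im
      Im-subspace .zero∈ = 𝟘 , 0-homo lin
      Im-subspace .add∈ (u , refl) (u′ , refl) = u ⊕ u′ , +-homo lin u u′
      Im-subspace .scale∈ c (u , refl) = c ⊙ u , ⊙-homo lin c u
      outside : ∀ {v} → W v → ¬ Im v → SpanL bs v
      outside {v} v∈ v∉im with χ v in col
      ... | true = contradiction (true⊆im (v∈ , (λ { refl → v∉im (zero∈ Im-subspace) }) , col)) v∉im
      ... | false = spans B (v∈ , (λ { refl → v∉im (zero∈ Im-subspace) }) , col)
      spans-bs : ∀ {v} → W v → SpanL bs v
      spans-bs {v} v∈ with ∃ᵛ? (λ u → φ u ≟ᵛ v)
      ... | no v∉im = outside v∈ v∉im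
      -- Here `v` is the difference of `v ⊕ w` and `w`, both outside the image.
      ... | yes v∈im = sub∈ SpanL-subspace
            (outside (add∈ sub v∈ w∈) (λ vw∈im → w∉im
              (sub∈ Im-subspace (subst Im (⊕-comm v w) vw∈im) v∈im)))
            (outside w∈ w∉im)
      -- The classes have equal rank, so the basis `as` of the class `true` would span `W` as well,
      -- forcing `w` into the image.
      spans-as : ∀ {v} → W v → SpanL as v
      spans-as v∈ = steinitz-spans (indep A) (All.map (spans-bs ∘ proj₁) (inside A))
        (ℕₚ.≤-reflexive (sym len)) (spans-bs v∈)
      im-as : ∀ {v} → SpanL as v → Im v
      im-as = SpanL-least Im-subspace (All.map true⊆im (inside A))

-- Points of projective space and their representing vectors.

module Points (F : Field) where

  open Linear F
  open Colourings F

  isZ-0 : isZ 0ᶠ ≡ true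
  isZ-0 = go F
    where
    go : ∀ F → isZ (0F F) ≡ true
    go GF2 = refl
    go GF3 = refl

  isO-1 : isO 1ᶠ ≡ true
  isO-1 = go F
    where
    go : ∀ F → isO (1F F) ≡ true
    go GF2 = refl
    go GF3 = refl

  isO⇒≡1 : ∀ x → isO x ≡ true → x ≡ 1ᶠ
  isO⇒≡1 = go F
    where
    go : ∀ F (x : Fq F) → isO x ≡ true → x ≡ 1F F
    go GF2 (Fin.suc Fin.zero) _ = refl
    go GF3 (Fin.suc Fin.zero) _ = refl

  isZ-≢0 : ∀ x → x ≢ 0ᶠ → isZ x ≡ false
  isZ-≢0 = go F
    where
    go : ∀ F (x : Fq F) → x ≢ 0F F → isZ x ≡ false
    go GF2 Fin.zero nz = contradiction refl nz
    go GF2 (Fin.suc _) _ = refl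
    go GF3 Fin.zero nz = contradiction refl nz
    go GF3 (Fin.suc _) _ = refl

  -- The first nonzero entry; the default 1 on the zero vector keeps it nonzero throughout.
  lead : ∀ {k} → V k → 𝔽
  lead [] = 1ᶠ
  lead (x ∷ v) with x ≟ 0ᶠ
  ... | yes _ = lead v
  ... | no _ = x

  lead≢0 : ∀ {k} (v : V k) → lead v ≢ 0ᶠ
  lead≢0 [] = 1≢0 F
  lead≢0 (x ∷ v) with x ≟ 0ᶠ
  ... | yes _ = lead≢0 v
  ... | no x≢0 = x≢0

  lead-⊙ : ∀ {k c} (v : V k) → c ≢ 0ᶠ → v ≢ 𝟘 → lead (c ⊙ v) ≡ c · lead v
  lead-⊙ [] _ v≢0 = contradiction refl v≢0
  lead-⊙ {c = c} (x ∷ v) c≢0 v≢0 with x ≟ 0ᶠ | c · x ≟ 0ᶠ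
  ... | yes refl | yes _ = lead-⊙ v c≢0 (v≢0 ∘ cong (0ᶠ ∷_))
  ... | yes refl | no cx≢0 = contradiction (·-zeroʳ F c) cx≢0
  ... | no x≢0 | yes cx≡0 = contradiction cx≡0 (·-nonzero c≢0 x≢0)
  ... | no _ | no _ = refl

  lead-normal : ∀ {k} (v : V k) → norm? v ≡ true → lead v ≡ 1ᶠ
  lead-normal [] ()
  lead-normal (x ∷ v) nv with x ≟ 0ᶠ
  ... | yes refl rewrite isZ-0 = lead-normal v nv
  ... | no x≢0 rewrite isZ-≢0 x x≢0 = isO⇒≡1 x nv

  -- Multiplying by the leading entry is dividing by it, which gives the canonical representative of
  -- a nonzero vector.
  nrm : ∀ {k} → V k → V k
  nrm v = lead v ⊙ v

  nrm-normal : ∀ {k} (v : V k) → v ≢ 𝟘 → norm? (nrm v) ≡ true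
  nrm-normal [] v≢0 = contradiction refl v≢0
  nrm-normal (x ∷ v) v≢0 with x ≟ 0ᶠ
  ... | yes refl rewrite ·-zeroʳ F (lead v) | isZ-0 = nrm-normal v (v≢0 ∘ cong (0ᶠ ∷_))
  ... | no x≢0 rewrite ·-square F x x≢0 | isZ-≢0 1ᶠ (1≢0 F) = isO-1

  nrm-⊙ : ∀ {k c} (v : V k) → c ≢ 0ᶠ → v ≢ 𝟘 → nrm (c ⊙ v) ≡ nrm v
  nrm-⊙ {c = c} v c≢0 v≢0 rewrite lead-⊙ v c≢0 v≢0 = begin
    (c · lead v) ⊙ c ⊙ v ≡⟨ sym (⊙-assoc c _ _) ⟩
    c ⊙ lead v ⊙ c ⊙ v   ≡⟨ cong (c ⊙_) (⊙-comm (lead v) c v) ⟩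
    c ⊙ c ⊙ nrm v        ≡⟨ ⊙-involutive (nrm v) c≢0 ⟩
    nrm v ∎
    where open ≡-Reasoning

  normal-nrm : ∀ {k} (v : V k) → norm? v ≡ true → nrm v ≡ v
  normal-nrm v nv rewrite lead-normal v nv = ⊙-identity v

  normal⇒≢0 : ∀ {k} (v : V k) → norm? v ≡ true → v ≢ 𝟘
  normal⇒≢0 (x ∷ v) nv refl rewrite isZ-0 = normal⇒≢0 v nv refl

  pt≢0 : ∀ {k} (p : Pt F k) → proj₁ p ≢ 𝟘
  pt≢0 (v , nv) = normal⇒≢0 v nv

  pt-≡ : ∀ {k} {p q : Pt F k} → proj₁ p ≡ proj₁ q → p ≡ q
  pt-≡ {p = _ , a} {_ , b} refl = cong (_ ,_) (uip a b)

  toPt : ∀ {k} (v : V k) → v ≢ 𝟘 → Pt F k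
  toPt v v≢0 = nrm v , nrm-normal v v≢0

  -- The `with` inside mkPt? cannot be abstracted again over norm? v, because the proof in its
  -- second argument mentions norm? v on both sides.  The vectors f s and f t are definitionally
  -- equal (η for ⊤) but syntactically distinct, so abstracting norm? (f t) spares norm? (f s).
  mkPt?-normal : ∀ {k} (f : ⊤ → V k) (s t : ⊤) (nv : norm? (f s) ≡ true) →
    mkPt? {F} (f t) ≡ just (f s , nv)
  mkPt?-normal f s t nv with norm? (f t) | (norm? (f s) ≡ norm? (f t)) ∋ refl
  ... | true | e = cong (λ e → just (f s , e)) (uip e nv)
  ... | false | e = contradiction (trans (sym nv) e) λ ()

  memV-point : ∀ {k} (T : PSet F k) v (nv : norm? v ≡ true) → memV T v ≡ T (v , nv)
  memV-point T v nv = cong (maybe T false) (mkPt?-normal (λ _ → v) tt tt nv)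

  -- Extends a point set to vectors, constant along the nonzero multiples of each nonzero vector.
  colour : ∀ {k} → PSet F k → Colouring k
  colour T v = memV T (nrm v)

  colour-toPt : ∀ {k} (T : PSet F k) {v} (v≢0 : v ≢ 𝟘) → colour T v ≡ T (toPt v v≢0)
  colour-toPt T {v} v≢0 = memV-point T (nrm v) (nrm-normal v v≢0)

  colour-pt : ∀ {k} (T : PSet F k) p → colour T (proj₁ p) ≡ T p
  colour-pt T p = trans (colour-toPt T (pt≢0 p)) (cong T (pt-≡ (normal-nrm _ (proj₂ p))))

  colour-⊙ : ∀ {k} (T : PSet F k) {c v} → c ≢ 0ᶠ → v ≢ 𝟘 → colour T (c ⊙ v) ≡ colour T v
  colour-⊙ T {v = v} c≢0 v≢0 = cong (memV T) (nrm-⊙ v c≢0 v≢0)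

  -- The cone over `S` without its apex: all nonzero multiples of representatives of its points.
  ⟦_⟧ : ∀ {k} → PSet F k → V k → Set
  ⟦ S ⟧ v = v ≢ 𝟘 × colour S v ≡ true

  ⟦_⟧? : ∀ {k} (S : PSet F k) → Decidable ⟦ S ⟧
  ⟦ S ⟧? v = ¬? (v ≟ᵛ 𝟘) ×-dec (colour S v ≟ᵇ true)

  ⟦⟧-⊙ : ∀ {k} (S : PSet F k) {c v} → c ≢ 0ᶠ → ⟦ S ⟧ v → ⟦ S ⟧ (c ⊙ v)
  ⟦⟧-⊙ S c≢0 (v≢0 , v∈) = ⊙-nonzero c≢0 v≢0 , trans (colour-⊙ S c≢0 v≢0) v∈

  ⟦⟧-pt : ∀ {k} (S : PSet F k) {p} → S p ≡ true → ⟦ S ⟧ (proj₁ p)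
  ⟦⟧-pt S {p} p∈ = pt≢0 p , trans (colour-pt S p) p∈

  -- Ranks as lengths of bases, and disconnectedness as separation.

  Basis-resp : ∀ {k} {P Q : V k → Set} {bs} → P ≐ Q → Basis P bs → Basis Q bs
  Basis-resp (P⊆Q , Q⊆P) B = basis (All.map P⊆Q (inside B)) (indep B) (spans B ∘ Q⊆P)

  Disc-resp : ∀ {k} {P Q : V k → Set} → P ≐ Q → Disc P → Disc Q
  Disc-resp (P⊆Q , Q⊆P) = Disc-push id-linear (λ _ eq → eq)
    record { to = P⊆Q ; from = Q⊆P ; onto = λ {v} _ → v , refl }

  -- A largest independent list of points spans: a vector outside its span normalises to a point
  -- that could be added.
  rank⇒basis : ∀ {k} {S : PSet F k} {n} → IsRank F S n →
    ∃ λ bs → Basis ⟦ S ⟧ bs × length bs ≡ n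
  rank⇒basis {S = S} ((xs , (xs⊆S , ind) , refl) , max) =
    List.map proj₁ xs ,
    basis (Allₚ.map⁺ (All.map (⟦⟧-pt S) xs⊆S)) ind′ spans′ ,
    Listₚ.length-map proj₁ xs
    where
    ind′ : Indep (List.map proj₁ xs)
    ind′ = LinInd⇒Indep _ ind
    spans′ : ∀ {v} → ⟦ S ⟧ v → SpanL (List.map proj₁ xs) v
    spans′ {v} (v≢0 , v∈) with SpanL? (List.map proj₁ xs) v
    ... | yes p = p
    ... | no v∉ = contradiction
          (max (toPt v v≢0 ∷ xs)
            ( trans (sym (colour-toPt S v≢0)) v∈ ∷ xs⊆S
            , Indep⇒LinInd _ ((v∉ ∘ unscale∈ SpanL-subspace (lead≢0 v)) , ind′)))
          (ℕₚ.<-irrefl refl)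

  -- Normalising the basis vectors gives independent points, and Steinitz bounds every other
  -- independent list.
  basis⇒rank : ∀ {k} {S : PSet F k} {bs} → Basis ⟦ S ⟧ bs → IsRank F S (length bs)
  basis⇒rank {S = S} {bs} B = independent , maximal
    where
    points : ∀ {bs} → All ⟦ S ⟧ bs →
      ∃ λ xs → InSet S xs × ScaledImage id bs (List.map proj₁ xs) × length xs ≡ length bs
    points [] = [] , [] , [] , refl
    points (_∷_ {v} (v≢0 , v∈) vs) with points vs
    ... | xs , xs⊆S , rel , len =
      toPt v v≢0 ∷ xs , trans (sym (colour-toPt S v≢0)) v∈ ∷ xs⊆S ,
      (lead v , lead≢0 v , refl) ∷ rel , cong suc len
    independent : Σ (List _) λ xs → IndepIn F S xs × length xs ≡ length bs
    independent with points (inside B)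
    ... | xs , xs⊆S , rel , len =
      xs , (xs⊆S , Indep⇒LinInd _ (Indep-push id-linear (λ _ eq → eq) rel (indep B))) , len
    maximal : ∀ ys → IndepIn F S ys → length ys ≤ length bs
    maximal ys (ys⊆S , ind) = subst (_≤ length bs) (Listₚ.length-map proj₁ ys)
      (steinitz (LinInd⇒Indep _ ind) (Allₚ.map⁺ (All.map (spans B ∘ ⟦⟧-pt S) ys⊆S)))

  SameRank⇒SameRankᵛ : ∀ {k} {S T : PSet F k} {P Q} → ⟦ S ⟧ ≐ P → ⟦ T ⟧ ≐ Q →
    SameRank F S T → SameRankᵛ P Q
  SameRank⇒SameRankᵛ S≐P T≐Q (n , rS , rT) with rank⇒basis rS | rank⇒basis rT
  ... | as , A , lenA | bs , B , lenB =
    as , bs , Basis-resp S≐P A , Basis-resp T≐Q B , trans lenA (sym lenB)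

  SameRankᵛ⇒SameRank : ∀ {k} {S T : PSet F k} {P Q} → P ≐ ⟦ S ⟧ → Q ≐ ⟦ T ⟧ →
    SameRankᵛ P Q → SameRank F S T
  SameRankᵛ⇒SameRank {S = S} {T} P≐S Q≐T (as , bs , A , B , len) =
    length as , basis⇒rank {S = S} (Basis-resp P≐S A) ,
    subst (IsRank F T) (sym len) (basis⇒rank {S = T} (Basis-resp Q≐T B))

  SpanL-++ : ∀ {k} (as : List (V k)) {bs v} → SpanL (as ++ bs) v →
    ∃ λ u → ∃ λ w → SpanL as u × SpanL bs w × u ⊕ w ≡ v
  SpanL-++ as {bs} = SpanL-least sum-subspace (All.tabulate generator)
    where
    Sum : V _ → Set
    Sum v = ∃ λ u → ∃ λ w → SpanL as u × SpanL bs w × u ⊕ w ≡ v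
    sum-subspace : Subspace Sum
    sum-subspace .zero∈ = 𝟘 , 𝟘 , zero∈ SpanL-subspace , zero∈ SpanL-subspace , ⊕-identityˡ 𝟘
    sum-subspace .add∈ (u , w , u∈ , w∈ , refl) (u′ , w′ , u′∈ , w′∈ , refl) =
      u ⊕ u′ , w ⊕ w′ , add∈ SpanL-subspace u∈ u′∈ , add∈ SpanL-subspace w∈ w′∈ ,
      ⊕-interchange u u′ w w′
    sum-subspace .scale∈ c (u , w , u∈ , w∈ , refl) =
      c ⊙ u , c ⊙ w , scale∈ SpanL-subspace c u∈ , scale∈ SpanL-subspace c w∈ ,
      sym (⊙-distribˡ c u w)
    generator : ∀ {v} → v ∈ as ++ bs → Sum v
    generator {v} v∈ with ∈-++⁻ as v∈
    ... | inj₁ p = v , 𝟘 , ∈⇒SpanL p , zero∈ SpanL-subspace , ⊕-identityʳ v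
    ... | inj₂ p = 𝟘 , v , zero∈ SpanL-subspace , ∈⇒SpanL p , ⊕-identityˡ v

  -- If the head `a` of the first list is `u ⊕ w`, with `u` from the remaining `as` and `w` from
  -- `bs`, then `w` is `a` minus `u` and lies in both spans. So `w` is zero and `a` depends on the
  -- remaining `as`.
  Indep-++ : ∀ {k} {as bs : List (V k)} → Indep as → Indep bs →
    (∀ {v} → SpanL as v → SpanL bs v → v ≡ 𝟘) → Indep (as ++ bs)
  Indep-++ {as = []} _ indb _ = indb
  Indep-++ {as = a ∷ as} {bs} (a∉ , inda) indb meet =
    a∉′ , Indep-++ inda indb (meet ∘ SpanL-there)
    where
    a∉′ : ¬ SpanL (as ++ bs) a
    a∉′ s with SpanL-++ as s
    ... | u , w , u∈ , w∈ , refl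
      with meet (subst (SpanL (a ∷ as)) (trans (cong (_⊕ -1ᶠ ⊙ u) (⊕-comm u w)) (⊕-cancelʳ w u))
             (add∈ SpanL-subspace (∈⇒SpanL (here refl)) (scale∈ SpanL-subspace -1ᶠ (SpanL-there u∈)))) w∈
    ... | refl = a∉ (subst (SpanL as) (sym (⊕-identityʳ u)) u∈)

  ++-meet : ∀ {k} {as bs : List (V k)} → Indep (as ++ bs) →
    ∀ {v} → SpanL as v → SpanL bs v → v ≡ 𝟘
  ++-meet {as = []} _ (combo [] refl) _ = refl
  ++-meet {as = a ∷ as} {bs} (a∉ , ind) (combo (c ∷ cs) eq) v∈ with c ≟ 0ᶠ
  ... | yes refl = ++-meet ind (combo cs (trans (sym (drop-zero a (comb′ as cs))) eq)) v∈
  ... | no c≢0 = contradiction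
        (subst (SpanL (as ++ bs)) (sym (isolate c≢0 eq))
          (add∈ SpanL-subspace (scale∈ SpanL-subspace c (SpanL-mono (∈-++⁺ʳ as) v∈))
            (scale∈ SpanL-subspace (c · -1ᶠ) (SpanL-mono {as = as} ∈-++⁺ˡ (combo cs refl)))))
        a∉

  -- Greedy thinning. Equal lengths mean that nothing was discarded, so the list was independent
  -- from the start.
  extract : ∀ {k} (zs : List (V k)) → ∃ λ ys → (∀ {v} → SpanL zs v → SpanL ys v) ×
    length ys ≤ length zs × (length ys ≡ length zs → Indep zs)
  extract [] = [] , id , z≤n , _
  extract (z ∷ zs) with extract zs
  ... | ys , covers , le , ind with SpanL? ys z
  ... | yes z∈ = ys ,
        SpanL-least SpanL-subspace (z∈ ∷ All.tabulate (covers ∘ ∈⇒SpanL)) ,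
        ℕₚ.m≤n⇒m≤1+n le , λ eq → contradiction (subst (_≤ length zs) eq le) (ℕₚ.<-irrefl refl)
  ... | no z∉ = z ∷ ys ,
        SpanL-least SpanL-subspace
          (∈⇒SpanL (here refl) ∷ All.tabulate (SpanL-there ∘ covers ∘ ∈⇒SpanL)) ,
        s≤s le , λ eq → (z∉ ∘ covers) , ind (ℕₚ.suc-injective eq)

  spanning-Indep : ∀ {k} {xs zs : List (V k)} → Indep xs → All (SpanL zs) xs →
    length xs ≡ length zs → Indep zs
  spanning-Indep {zs = zs} ind xs⊆ len with extract zs
  ... | ys , covers , le , indz =
    indz (ℕₚ.≤-antisym le (subst (_≤ length ys) len (steinitz ind (All.map covers xs⊆))))

  colour-∩ : ∀ {k} (S T : PSet F k) {v} → v ≢ 𝟘 → colour (S ∩ T) v ≡ colour S v ∧ colour T v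
  colour-∩ S T v≢0 = trans (colour-toPt (S ∩ T) v≢0)
    (sym (cong₂ _∧_ (colour-toPt S v≢0) (colour-toPt T v≢0)))

  colour-not : ∀ {k} (S : PSet F k) {v} → v ≢ 𝟘 → colour (not ∘ S) v ≡ not (colour S v)
  colour-not S v≢0 = trans (colour-toPt (not ∘ S) v≢0) (sym (cong not (colour-toPt S v≢0)))

  -- Closure under nonzero scalars allows `P` to be tested on the normalised representative.
  colour-⌊⌋ : ∀ {k} {P : V k → Set} (P? : Decidable P) → (∀ {c v} → c ≢ 0ᶠ → P v → P (c ⊙ v)) →
    ∀ {v} → v ≢ 𝟘 → (colour (λ p → ⌊ P? (proj₁ p) ⌋) v ≡ true → P v) ×
                     (P v → colour (λ p → ⌊ P? (proj₁ p) ⌋) v ≡ true)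
  colour-⌊⌋ {P = P} P? P-⊙ {v} v≢0 rewrite colour-toPt (λ p → ⌊ P? (proj₁ p) ⌋) v≢0
    with P? (nrm v)
  ... | yes p = (λ _ → subst P (⊙-involutive v (lead≢0 v)) (P-⊙ (lead≢0 v) p)) , λ _ → refl
  ... | no ¬p = (λ ()) , λ p → contradiction (P-⊙ (lead≢0 v) p) ¬p

  ∧-true⁻ : ∀ {a b} → a ∧ b ≡ true → a ≡ true × b ≡ true
  ∧-true⁻ {true} {true} _ = refl , refl

  not-true⁻ : ∀ {a} → not a ≡ true → a ≡ false
  not-true⁻ {false} _ = refl

  -- As the spans of the parts meet trivially, bases of the parts join to a basis of `X`, and ranks
  -- add.
  Disc⇒Disconnected : ∀ {k} {X : PSet F k} → Disc ⟦ X ⟧ → Disconnected F X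
  Disc⇒Disconnected {X = X} D =
    A′ , (λ p p∈ → trans (sym (colour-pt X p)) (proj₂ (A⊆ (proj₁ A′≐A (⟦⟧-pt A′ {p} p∈))))) ,
    nonempty {S = A′} (proj₂ A′≐A (proj₂ A-nonempty)) ,
    nonempty {S = X ─ A′} (proj₂ R′≐R (proj₂ rest-nonempty)) ,
    ranks
    where
    open Disc D
    -- Makes `A` a set of points: if a nonzero multiple fell in the other part, it would lie in both
    -- spans.
    A-⊙ : ∀ {c v} → c ≢ 0ᶠ → A v → A (c ⊙ v)
    A-⊙ {c} {v} c≢0 a with A? (c ⊙ v)
    ... | yes a′ = a′
    ... | no ¬a = contradiction
          (meet-trivial (scale∈ Span-subspace c (⊆Span a)) (⊆Span (⟦⟧-⊙ X c≢0 (A⊆ a) , ¬a)))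
          (⊙-nonzero c≢0 (proj₁ (A⊆ a)))
    A′ : PSet F _
    A′ p = ⌊ A? (proj₁ p) ⌋
    A′≐A : ⟦ A′ ⟧ ≐ A
    A′≐A = (λ (v≢0 , v∈) → proj₁ (colour-⌊⌋ A? A-⊙ v≢0) v∈) ,
           (λ a → proj₁ (A⊆ a) , proj₂ (colour-⌊⌋ A? A-⊙ (proj₁ (A⊆ a))) a)
    R : V _ → Set
    R v = ⟦ X ⟧ v × ¬ A v
    R′≐R : ⟦ X ─ A′ ⟧ ≐ R
    R′≐R = (λ {v} (v≢0 , v∈) →
             let x , ¬a = ∧-true⁻ (trans (sym (trans (colour-∩ X (not ∘ A′) v≢0)
                            (cong (colour X v ∧_) (colour-not A′ v≢0)))) v∈)
             in (v≢0 , x) , λ a → case-⊥ (trans (sym (proj₂ (proj₂ A′≐A a))) (not-true⁻ ¬a))) ,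
           (λ {v} ((v≢0 , x) , ¬a) → v≢0 ,
             trans (colour-∩ X (not ∘ A′) v≢0) (cong₂ _∧_ x (trans (colour-not A′ v≢0)
               (cong not (Boolₚ.¬-not (λ eq → ¬a (proj₁ A′≐A (v≢0 , eq))))))))
      where
      case-⊥ : ∀ {A : Set} → true ≡ false → A
      case-⊥ ()
    nonempty : ∀ {S : PSet F _} {v} → ⟦ S ⟧ v → NonEmpty S
    nonempty {S} {v} (v≢0 , v∈) = toPt v v≢0 , trans (sym (colour-toPt S v≢0)) v∈
    ranks : Σ ℕ λ a → Σ ℕ λ b → IsRank F A′ a × IsRank F (X ─ A′) b × IsRank F X (a ℕ.+ b)
    ranks with ∃basis A? | ∃basis (λ v → ⟦ X ⟧? v ×-dec ¬? (A? v))
    ... | as , BA | bs , BR =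
      length as , length bs ,
      basis⇒rank (Basis-resp (proj₂ A′≐A , proj₁ A′≐A) BA) ,
      basis⇒rank {S = X ─ A′} (Basis-resp (proj₂ R′≐R , proj₁ R′≐R) BR) ,
      subst (IsRank F X) (Listₚ.length-++ as) (basis⇒rank (basis
        (Allₚ.++⁺ (All.map A⊆ (inside BA)) (All.map proj₁ (inside BR)))
        (Indep-++ (indep BA) (indep BR) (λ s t →
          meet-trivial (SpanL⇒Span (inside BA) s) (SpanL⇒Span (inside BR) t)))
        spansX))
      where
      spansX : ∀ {v} → ⟦ X ⟧ v → SpanL (as ++ bs) v
      spansX {v} x with A? v
      ... | yes a = SpanL-mono ∈-++⁺ˡ (spans BA a)
      ... | no ¬a = SpanL-mono (∈-++⁺ʳ as) (spans BR (x , ¬a))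

  -- Bases of the two parts together span `X` and number exactly its rank. They are therefore
  -- jointly independent, so their spans meet only in zero.
  Disconnected⇒Disc : ∀ {k} {X : PSet F k} → Disconnected F X → Disc ⟦ X ⟧
  Disconnected⇒Disc {X = X} (A , A⊆X , (p , p∈) , (q , q∈) , a , b , rA , rR , rX)
    with rank⇒basis rA | rank⇒basis rR | rank⇒basis rX
  ... | as , BA , refl | bs , BR , refl | xs , BX , len = record
    { A = ⟦ A ⟧
    ; A? = ⟦ A ⟧?
    ; A⊆ = λ (v≢0 , v∈) → v≢0 ,
        trans (colour-toPt X v≢0) (A⊆X _ (trans (sym (colour-toPt A v≢0)) v∈))
    ; A-nonempty = proj₁ p , ⟦⟧-pt A p∈
    ; rest-nonempty = proj₁ q , ⟦⟧-pt X (proj₁ (∧-true⁻ q∈)) ,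
        λ (_ , q∈A) → true≢false (trans (sym q∈A)
          (trans (colour-pt A q) (not-true⁻ (proj₂ (∧-true⁻ q∈)))))
    ; meet-trivial = λ s t → ++-meet ind (Span⇒SpanL BA s)
        (Span⇒SpanL BR (Span-mono rest⊆ t))
    }
    where
    true≢false : true ≢ false
    true≢false ()
    rest⊆ : ∀ {v} → ⟦ X ⟧ v × ¬ ⟦ A ⟧ v → ⟦ X ─ A ⟧ v
    rest⊆ ((v≢0 , x) , ¬a) = v≢0 , trans (colour-∩ X (not ∘ A) v≢0)
      (cong₂ _∧_ x (trans (colour-not A v≢0) (cong not (Boolₚ.¬-not (λ eq → ¬a (v≢0 , eq))))))
    spansX : ∀ {v} → ⟦ X ⟧ v → SpanL (as ++ bs) v
    spansX {v} x with ⟦ A ⟧? v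
    ... | yes a = SpanL-mono ∈-++⁺ˡ (spans BA a)
    ... | no ¬a = SpanL-mono (∈-++⁺ʳ as) (spans BR (rest⊆ (x , ¬a)))
    ind : Indep (as ++ bs)
    ind = spanning-Indep (indep BX) (All.map spansX (inside BX))
      (trans len (sym (Listₚ.length-++ as)))

-- Flats of projective space as subspaces.

module Flats (F : Field) where

  open Linear F
  open Colourings F
  open Points F

  Condition : ∀ {k} → PSet F k → Set
  Condition E = ∀ Fl → IsFlat F Fl → NonEmpty Fl → SameRank F (Fl ∩ E) (Fl ─ E) →
    Disconnected F (Fl ∩ E) ⊎ Disconnected F (Fl ─ E)

  ≐-sym : ∀ {k} {P Q : V k → Set} → P ≐ Q → Q ≐ P
  ≐-sym (f , g) = g , f

  module _ {k} (E Fl : PSet F k) {W : V k → Set}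
           (rep : ∀ {v} → v ≢ 𝟘 → (colour Fl v ≡ true → W v) × (W v → colour Fl v ≡ true)) where

    ∩≐Mono : ⟦ Fl ∩ E ⟧ ≐ Mono (colour E) true W
    ∩≐Mono =
      (λ (v≢0 , v∈) → let f , e = ∧-true⁻ (trans (sym (colour-∩ Fl E v≢0)) v∈)
                      in proj₁ (rep v≢0) f , v≢0 , e) ,
      (λ (w , v≢0 , e) → v≢0 , trans (colour-∩ Fl E v≢0) (cong₂ _∧_ (proj₂ (rep v≢0) w) e))

    ─≐Mono : ⟦ Fl ─ E ⟧ ≐ Mono (colour E) false W
    ─≐Mono =
      (λ (v≢0 , v∈) → let f , ¬e = ∧-true⁻ (trans (sym (colour-∩ Fl (not ∘ E) v≢0)) v∈)
                      in proj₁ (rep v≢0) f , v≢0 , not-true⁻ (trans (sym (colour-not E v≢0)) ¬e)) ,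
      (λ (w , v≢0 , e) → v≢0 , trans (colour-∩ Fl (not ∘ E) v≢0)
        (cong₂ _∧_ (proj₂ (rep v≢0) w) (trans (colour-not E v≢0) (cong not e))))

  addPt-⊇ : ∀ {k} (S : PSet F k) p → addPt S p p ≡ true
  addPt-⊇ S p with Vecₚ.≡-dec Finₚ._≟_ (proj₁ p) (proj₁ p)
  ... | yes _ = Boolₚ.∨-zeroʳ (S p)
  ... | no p≢p = contradiction refl p≢p

  addPt⁻ : ∀ {k} (S : PSet F k) p {v} → ⟦ addPt S p ⟧ v → ⟦ S ⟧ v ⊎ nrm v ≡ proj₁ p
  addPt⁻ S p {v} (v≢0 , v∈) with S (toPt v v≢0) in eq
                               | Vecₚ.≡-dec Finₚ._≟_ (nrm v) (proj₁ p)
                               | trans (sym (colour-toPt (addPt S p) v≢0)) v∈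
  ... | true | _ | _ = inj₁ (v≢0 , trans (colour-toPt S v≢0) eq)
  ... | false | yes e | _ = inj₂ e
  ... | false | no _ | ()

  addPt-mono : ∀ {k} (S : PSet F k) p {v} → ⟦ S ⟧ v → ⟦ addPt S p ⟧ v
  addPt-mono S p {v} (v≢0 , v∈) = v≢0 , trans (colour-toPt (addPt S p) v≢0)
    (cong (_∨ ⌊ Vecₚ.≡-dec Finₚ._≟_ (nrm v) (proj₁ p) ⌋) (trans (sym (colour-toPt S v≢0)) v∈))

  SpanL-addPt : ∀ {k} (S : PSet F k) p {bs} → (∀ {v} → ⟦ S ⟧ v → SpanL bs v) → SpanL bs (proj₁ p) →
    ∀ {v} → ⟦ addPt S p ⟧ v → SpanL bs v
  SpanL-addPt S p spansS p∈ {v} v∈ with addPt⁻ S p v∈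
  ... | inj₁ v∈S = spansS v∈S
  ... | inj₂ eq = unscale∈ SpanL-subspace (lead≢0 v) (subst (SpanL _) (sym eq) p∈)

  ⌊⌋≡false : ∀ {A : Set} (A? : Dec A) → ⌊ A? ⌋ ≡ false → ¬ A
  ⌊⌋≡false (no ¬a) _ = ¬a

  -- A point outside `W` is not in the span of a basis inside `W`, so adding it raises the rank by
  -- one.
  flat-of-subspace : ∀ {k} {W : V k → Set} (W? : Decidable W) → Subspace W →
    IsFlat F (λ p → ⌊ W? (proj₁ p) ⌋)
  flat-of-subspace {W = W} W? sub p p∉ n rank with rank⇒basis rank
  ... | bs , B , refl = basis⇒rank {S = addPt Fl p} (basis
        (⟦⟧-pt (addPt Fl p) {p} (addPt-⊇ Fl p) ∷ All.map (addPt-mono Fl p) (inside B))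
        (p∉SpanL , indep B)
        (SpanL-addPt Fl p (SpanL-there ∘ spans B) (∈⇒SpanL (here refl))))
    where
    Fl : PSet F _
    Fl p = ⌊ W? (proj₁ p) ⌋
    Fl⇒W : ∀ {v} → ⟦ Fl ⟧ v → W v
    Fl⇒W (v≢0 , v∈) = proj₁ (colour-⌊⌋ W? (λ {c} _ → scale∈ sub c) v≢0) v∈
    p∉SpanL : ¬ SpanL bs (proj₁ p)
    p∉SpanL p∈ = ⌊⌋≡false (W? (proj₁ p)) p∉ (SpanL-least sub (All.map Fl⇒W (inside B)) p∈)

  -- Adding a missing point of the span of a flat would raise the rank, although a basis of the flat
  -- already spans that point.
  subspace-of-flat : ∀ {k} (Fl : PSet F k) → IsFlat F Fl →
    Subspace (λ v → v ≡ 𝟘 ⊎ ⟦ Fl ⟧ v)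
  subspace-of-flat Fl flat = sub
    where
    W : V _ → Set
    W v = v ≡ 𝟘 ⊎ ⟦ Fl ⟧ v
    closed : ∀ {v} → v ≢ 𝟘 → (∀ {bs} → Basis ⟦ Fl ⟧ bs → SpanL bs v) → colour Fl v ≡ true
    closed {v} v≢0 v∈ with colour Fl v in eq
    ... | true = refl
    ... | false with ∃basis ⟦ Fl ⟧?
    ...   | bs , B with rank⇒basis (flat (toPt v v≢0) (trans (sym (colour-toPt Fl v≢0)) eq) _ (basis⇒rank B))
    ...     | bs′ , B′ , len = contradiction
              (subst (_≤ length bs) len (steinitz (indep B′)
                (All.map (SpanL-addPt Fl (toPt v v≢0) (spans B) (scale∈ SpanL-subspace (lead v) (v∈ B)))
                  (inside B′))))
              (ℕₚ.<-irrefl refl)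
    W⊆SpanL : ∀ {bs} → Basis ⟦ Fl ⟧ bs → ∀ {v} → W v → SpanL bs v
    W⊆SpanL B (inj₁ refl) = zero∈ SpanL-subspace
    W⊆SpanL B (inj₂ v∈) = spans B v∈
    sub : Subspace W
    sub .zero∈ = inj₁ refl
    sub .add∈ {u} {v} u∈ v∈ with u ⊕ v ≟ᵛ 𝟘
    ... | yes eq = inj₁ eq
    ... | no uv≢0 = inj₂ (uv≢0 , closed uv≢0 (λ B → add∈ SpanL-subspace (W⊆SpanL B u∈) (W⊆SpanL B v∈)))
    sub .scale∈ c (inj₁ refl) = inj₁ (⊙-zeroʳ c)
    sub .scale∈ c {v} (inj₂ v∈) with c ≟ 0ᶠ
    ... | yes refl = inj₁ (⊙-zeroˡ v)
    ... | no c≢0 = inj₂ (⟦⟧-⊙ Fl c≢0 v∈)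

  Condition⇒Good : ∀ {k} {E : PSet F k} → Condition E → Good (colour E)
  Condition⇒Good {E = E} cond W W? sub (w , w∈ , w≢0) same =
    Sum.map
      (λ D → Disc-resp (∩≐Mono E Fl rep) (Disconnected⇒Disc {X = Fl ∩ E} D))
      (λ D → Disc-resp (─≐Mono E Fl rep) (Disconnected⇒Disc {X = Fl ─ E} D))
      (cond Fl (flat-of-subspace W? sub)
        (toPt w w≢0 , trans (sym (colour-toPt Fl w≢0)) (proj₂ (rep w≢0) w∈))
        (SameRankᵛ⇒SameRank {S = Fl ∩ E} {T = Fl ─ E}
          (≐-sym (∩≐Mono E Fl rep)) (≐-sym (─≐Mono E Fl rep)) same))
    where
    Fl : PSet F _
    Fl p = ⌊ W? (proj₁ p) ⌋
    rep : ∀ {v} → v ≢ 𝟘 → (colour Fl v ≡ true → W v) × (W v → colour Fl v ≡ true)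
    rep = colour-⌊⌋ W? (λ {c} _ → scale∈ sub c)

  Good⇒Condition : ∀ {k} {E : PSet F k} → Good (colour E) → Condition E
  Good⇒Condition {E = E} good Fl flat (p , p∈) same =
    Sum.map
      (λ D → Disc⇒Disconnected {X = Fl ∩ E} (Disc-resp (≐-sym (∩≐Mono E Fl rep)) D))
      (λ D → Disc⇒Disconnected {X = Fl ─ E} (Disc-resp (≐-sym (─≐Mono E Fl rep)) D))
      (good W (λ v → (v ≟ᵛ 𝟘) ⊎-dec ⟦ Fl ⟧? v) (subspace-of-flat Fl flat)
        (proj₁ p , inj₂ (⟦⟧-pt Fl {p} p∈) , pt≢0 p)
        (SameRank⇒SameRankᵛ {S = Fl ∩ E} {T = Fl ─ E} (∩≐Mono E Fl rep) (─≐Mono E Fl rep) same))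
    where
    W : V _ → Set
    W v = v ≡ 𝟘 ⊎ ⟦ Fl ⟧ v
    rep : ∀ {v} → v ≢ 𝟘 → (colour Fl v ≡ true → W v) × (W v → colour Fl v ≡ true)
    rep v≢0 = (λ v∈ → inj₂ (v≢0 , v∈)) , [ (λ eq → contradiction eq v≢0) , proj₂ ]′

-- Scalar identities for combining two functionals.

combination-+ : ∀ F a b p q r s →
  addF F (mulF F a (addF F p q)) (mulF F b (addF F r s)) ≡
  addF F (addF F (mulF F a p) (mulF F b r)) (addF F (mulF F a q) (mulF F b s))
combination-+ F a b p q r s rewrite ·-distribˡ F a p q | ·-distribˡ F b r s =
  cong Vec.head (Linear.⊕-interchange F
    (mulF F a p ∷ []) (mulF F a q ∷ []) (mulF F b r ∷ []) (mulF F b s ∷ []))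

combination-· : ∀ F a b c p r →
  addF F (mulF F a (mulF F c p)) (mulF F b (mulF F c r)) ≡
  mulF F c (addF F (mulF F a p) (mulF F b r))
combination-· F a b c p r
  rewrite ·-distribˡ F c (mulF F a p) (mulF F b r)
        | sym (·-assoc F a c p) | sym (·-assoc F b c r) | ·-comm F a c | ·-comm F b c
        | ·-assoc F c a p | ·-assoc F c b r = refl

-- With `p` and `q` the values of two functionals at a new element, this is the value there of the
-- combination that is formed in `combine`.
antisymmetric : ∀ F p q → addF F (mulF F q p) (mulF F (mulF F (-1F F) p) q) ≡ 0F F
antisymmetric = law₂ _ _

elimination : ∀ F p e → e ≢ 0F F → addF F p (mulF F (mulF F (-1F F) (mulF F e p)) e) ≡ 0F F
elimination GF2 = toWitness {a? = Finₚ.all? λ p → Finₚ.all? λ e → ¬? (e ≟ _) →-dec (_ ≟ _)} tt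
elimination GF3 = toWitness {a? = Finₚ.all? λ p → Finₚ.all? λ e → ¬? (e ≟ _) →-dec (_ ≟ _)} tt

-- Let `d` and `e` be the values of two functionals at a new element, `p` and `q` those at a vector.
-- The hypothesis makes the pairs proportional, so the multiple of the new element that cancels `p`
-- cancels `q` too.
elimination′ : ∀ F d e p q → d ≢ 0F F → addF F (mulF F e p) (mulF F (mulF F (-1F F) d) q) ≡ 0F F →
  addF F q (mulF F (mulF F (-1F F) (mulF F d p)) e) ≡ 0F F
elimination′ GF2 = toWitness {a? = Finₚ.all? λ d → Finₚ.all? λ e → Finₚ.all? λ p → Finₚ.all? λ q →
  ¬? (d ≟ _) →-dec ((_ ≟ _) →-dec (_ ≟ _))} tt
elimination′ GF3 = toWitness {a? = Finₚ.all? λ d → Finₚ.all? λ e → Finₚ.all? λ p → Finₚ.all? λ q →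
  ¬? (d ≟ _) →-dec ((_ ≟ _) →-dec (_ ≟ _))} tt

-- Unique representability over GF(2) and GF(3).

module Uniqueness (F : Field) where

  open Linear F

  lookup-ext : ∀ {k} {u v : V k} → (∀ i → Vec.lookup u i ≡ Vec.lookup v i) → u ≡ v
  lookup-ext {u = u} {v} h = trans (sym (Vecₚ.tabulate∘lookup u))
    (trans (Vecₚ.tabulate-cong h) (Vecₚ.tabulate∘lookup v))

  lookup-⊕ : ∀ {k} (u v : V k) i → Vec.lookup (u ⊕ v) i ≡ Vec.lookup u i +ᶠ Vec.lookup v i
  lookup-⊕ u v i = Vecₚ.lookup-zipWith _+ᶠ_ i u v

  lookup-⊙ : ∀ {k} c (v : V k) i → Vec.lookup (c ⊙ v) i ≡ c · Vec.lookup v i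
  lookup-⊙ c v i = Vecₚ.lookup-map i (c ·_) v

  lookup-𝟘 : ∀ {k} (i : Fin k) → Vec.lookup 𝟘 i ≡ 0ᶠ
  lookup-𝟘 i = Vecₚ.lookup-replicate i 0ᶠ

  lookup-unit-≢ : ∀ {k} {i l : Fin k} → i ≢ l → Vec.lookup (unit l) i ≡ 0ᶠ
  lookup-unit-≢ {i = Fin.zero} {Fin.zero} i≢l = contradiction refl i≢l
  lookup-unit-≢ {i = Fin.suc i} {Fin.zero} _ = lookup-𝟘 i
  lookup-unit-≢ {i = Fin.zero} {Fin.suc l} _ = refl
  lookup-unit-≢ {i = Fin.suc i} {Fin.suc l} i≢l = lookup-unit-≢ (i≢l ∘ cong Fin.suc)

  nonzero-entry : ∀ {k} (v : V k) → v ≢ 𝟘 → ∃ λ i → Vec.lookup v i ≢ 0ᶠ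
  nonzero-entry v v≢0 with Finₚ.any? (λ i → ¬? (Vec.lookup v i ≟ 0ᶠ))
  ... | yes p = p
  ... | no ∄i = contradiction
        (lookup-ext λ i → trans (decidable-stable (Vec.lookup v i ≟ 0ᶠ) (λ nz → ∄i (i , nz))) (sym (lookup-𝟘 i)))
        v≢0

  diag : ∀ {k} → V k → V k → V k
  diag = zipWith _·_

  lookup-diag : ∀ {k} (s v : V k) i → Vec.lookup (diag s v) i ≡ Vec.lookup s i · Vec.lookup v i
  lookup-diag s v i = Vecₚ.lookup-zipWith _·_ i s v

  diag-linear : ∀ {k} (s : V k) → Linear (diag s)
  diag-linear [] .+-homo [] [] = refl
  diag-linear (a ∷ s) .+-homo (b ∷ u) (c ∷ v) =
    cong₂ _∷_ (·-distribˡ F a b c) (diag-linear s .+-homo u v)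
  diag-linear [] .⊙-homo c [] = refl
  diag-linear (a ∷ s) .⊙-homo c (b ∷ v) = cong₂ _∷_
    (trans (sym (·-assoc F a c b)) (trans (cong (_· b) (·-comm F a c)) (·-assoc F c a b)))
    (diag-linear s .⊙-homo c v)

  diag-diag : ∀ {k} (s t v : V k) → diag (diag s t) v ≡ diag s (diag t v)
  diag-diag = Vecₚ.zipWith-assoc (·-assoc F)

  NonzeroEntries : ∀ {k} → V k → Set
  NonzeroEntries s = ∀ i → Vec.lookup s i ≢ 0ᶠ

  diag-involutive : ∀ {k} {s : V k} → NonzeroEntries s → ∀ v → diag s (diag s v) ≡ v
  diag-involutive {s = s} nz v = lookup-ext λ i →
    trans (lookup-diag s (diag s v) i)
      (trans (cong (Vec.lookup s i ·_) (lookup-diag s v i)) (·-cancel-square _ (nz i)))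

  record Functional {k} (f : V k → 𝔽) : Set where
    field
      f-⊕ : ∀ u v → f (u ⊕ v) ≡ f u +ᶠ f v
      f-⊙ : ∀ c v → f (c ⊙ v) ≡ c · f v

    f-𝟘 : f 𝟘 ≡ 0ᶠ
    f-𝟘 = trans (cong f (sym (⊙-zeroˡ 𝟘))) (trans (f-⊙ 0ᶠ 𝟘) (·-zeroˡ F _))

    kernel : Subspace (λ v → f v ≡ 0ᶠ)
    kernel .zero∈ = f-𝟘
    kernel .add∈ {u} {v} p q = trans (f-⊕ u v) (trans (cong₂ _+ᶠ_ p q) (+ᶠ-identityˡ F 0ᶠ))
    kernel .scale∈ c {v} p = trans (f-⊙ c v) (trans (cong (c ·_) p) (·-zeroʳ F c))

  open Functional

  -- Here the smallness of the field enters: the only nonzero scalars are 1 and -1, so scalars that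
  -- vanish together agree up to sign.
  ±-equal : ∀ p q → (p ≡ 0ᶠ → q ≡ 0ᶠ) × (q ≡ 0ᶠ → p ≡ 0ᶠ) → p +ᶠ q ≡ 0ᶠ ⊎ p +ᶠ -1ᶠ · q ≡ 0ᶠ
  ±-equal = go F
    where
    go : ∀ F (p q : Fq F) → (p ≡ 0F F → q ≡ 0F F) × (q ≡ 0F F → p ≡ 0F F) →
      addF F p q ≡ 0F F ⊎ addF F p (mulF F (-1F F) q) ≡ 0F F
    go GF2 = toWitness {a? = Finₚ.all? λ p → Finₚ.all? λ q →
      (((p ≟ _) →-dec (q ≟ _)) ×-dec ((q ≟ _) →-dec (p ≟ _))) →-dec ((_ ≟ _) ⊎-dec (_ ≟ _))} tt
    go GF3 = toWitness {a? = Finₚ.all? λ p → Finₚ.all? λ q →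
      (((p ≟ _) →-dec (q ≟ _)) ×-dec ((q ≟ _) →-dec (p ≟ _))) →-dec ((_ ≟ _) ⊎-dec (_ ≟ _))} tt

  +≡0⇒≡neg : ∀ p q → p +ᶠ q ≡ 0ᶠ → q ≡ -1ᶠ · p
  +≡0⇒≡neg = go F
    where
    go : ∀ F p q → addF F p q ≡ 0F F → q ≡ mulF F (-1F F) p
    go GF2 = toWitness {a? = Finₚ.all? λ p → Finₚ.all? λ q → (_ ≟ _) →-dec (_ ≟ _)} tt
    go GF3 = toWitness {a? = Finₚ.all? λ p → Finₚ.all? λ q → (_ ≟ _) →-dec (_ ≟ _)} tt

  -≡0⇒≡ : ∀ p q → p +ᶠ -1ᶠ · q ≡ 0ᶠ → q ≡ p
  -≡0⇒≡ = go F
    where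
    go : ∀ F p q → addF F p (mulF F (-1F F) q) ≡ 0F F → q ≡ p
    go GF2 = toWitness {a? = Finₚ.all? λ p → Finₚ.all? λ q → (_ ≟ _) →-dec (_ ≟ _)} tt
    go GF3 = toWitness {a? = Finₚ.all? λ p → Finₚ.all? λ q → (_ ≟ _) →-dec (_ ≟ _)} tt

  module _ {n} {I : Set} (x y : I → V n) (x≢0 : ∀ e → x e ≢ 𝟘)
           (u : Fin n → I) (x-u : ∀ i → x (u i) ≡ unit i) (y-u : ∀ i → y (u i) ≡ unit i)
           (closure : ∀ e js → SpanL (List.map x js) (x e) → SpanL (List.map y js) (y e))
           (closure⁻ : ∀ e js → SpanL (List.map y js) (y e) → SpanL (List.map x js) (x e)) where

    infix 8 _!_
    _!_ : V n → Fin n → 𝔽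
    v ! i = Vec.lookup v i

    Vanishes : (Fin n → Fin n) → Fin n → V n → Set
    Vanishes label C v = ∀ k → label k ≡ C → v ! k ≡ 0ᶠ

    -- The kernel is a hyperplane spanned by elements of `J`, so the elements of `J` outside it form
    -- a cocircuit. The vectors `a` and `b` that it must detect need not be elements: they will be
    -- the sum and difference of two images of a new element.
    record Cocircuit (J : List I) (label : Fin n → Fin n) (C : Fin n) (a b : V n) : Set where
      field
        f : V n → 𝔽
        functional : Functional f
        fa≢0 : f a ≢ 0ᶠ
        fb≢0 : f b ≢ 0ᶠ
        support : ∀ {v} → Vanishes label C v → f v ≡ 0ᶠ
        kernel-spanned : ∀ {v} → f v ≡ 0ᶠ → Span (λ w → ∃ λ j → j ∈ J × x j ≡ w × f w ≡ 0ᶠ) v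

    open Cocircuit

    -- Coordinates with the same label are those in the same connected component of the matroid on J.
    record State (J : List I) : Set where
      field
        label : Fin n → Fin n
        s : V n
        s≢0 : NonzeroEntries s
        scaled : ∀ {j} → j ∈ J → ∃ λ c → c ≢ 0ᶠ × y j ≡ c ⊙ diag s (x j)
        in-class : ∀ {j} → j ∈ J → ∃ λ C → ∀ i → x j ! i ≢ 0ᶠ → label i ≡ C
        u∈ : ∀ i → u i ∈ J
        cocircuit : ∀ a b i l → a ! i ≢ 0ᶠ → b ! l ≢ 0ᶠ → label i ≡ label l →
          Cocircuit J label (label i) a b

    -- On the basis alone each coordinate is a component of its own, detected by its coordinate
    -- functional, and both representations coincide.
    initial : State (List.tabulate u)
    initial = record
      { label = id
      ; s = replicate n 1ᶠ
      ; s≢0 = λ i eq → 1≢0 F (trans (sym (Vecₚ.lookup-replicate i 1ᶠ)) eq)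
      ; scaled = λ j∈ → 1ᶠ , 1≢0 F , scaled′ (∈-tabulate⁻ j∈)
      ; in-class = λ j∈ → in-class′ (∈-tabulate⁻ j∈)
      ; u∈ = ∈-tabulate⁺
      ; cocircuit = cocircuit′
      }
      where
      diag-1 : ∀ v → diag (replicate n 1ᶠ) v ≡ v
      diag-1 = Vecₚ.zipWith-identityˡ (·-identityˡ F)
      scaled′ : ∀ {j} → (∃ λ i → j ≡ u i) → y j ≡ 1ᶠ ⊙ diag (replicate n 1ᶠ) (x j)
      scaled′ (i , refl) = trans (y-u i) (trans (sym (x-u i)) (sym (trans (⊙-identity _) (diag-1 _))))
      in-class′ : ∀ {j} → (∃ λ i → j ≡ u i) → ∃ λ C → ∀ i → x j ! i ≢ 0ᶠ → i ≡ C
      in-class′ (i , refl) = i , λ k nz → decidable-stable (k ≟ i)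
        (λ k≢i → nz (trans (cong (_! k) (x-u i)) (lookup-unit-≢ k≢i)))
      cocircuit′ : ∀ a b i l → a ! i ≢ 0ᶠ → b ! l ≢ 0ᶠ → i ≡ l → Cocircuit (List.tabulate u) id i a b
      cocircuit′ a b i .i ai≢0 bi≢0 refl = record
        { f = _! i
        ; functional = record { f-⊕ = λ v w → lookup-⊕ v w i ; f-⊙ = λ c v → lookup-⊙ c v i }
        ; fa≢0 = ai≢0
        ; fb≢0 = bi≢0
        ; support = λ van → van i refl
        ; kernel-spanned = λ {v} vi≡0 → unit-induction Span-subspace v (generator {v} vi≡0)
        }
        where
        generator : ∀ {v} → v ! i ≡ 0ᶠ → ∀ k → v ! k ≡ 0ᶠ ⊎
          Span (λ w → ∃ λ j → j ∈ List.tabulate u × x j ≡ w × w ! i ≡ 0ᶠ) (unit k)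
        generator vi≡0 k with i ≟ k
        ... | yes refl = inj₁ vi≡0
        ... | no i≢k = inj₂ (⊆Span (u k , ∈-tabulate⁺ k , x-u k , lookup-unit-≢ i≢k))

    -- The closure hypotheses speak of lists of elements, so the elements used in a span are
    -- collected in one.
    Span⇒list : ∀ {P : I → V n → Set} {v} → Span (λ w → ∃ λ j → x j ≡ w × P j w) v →
      ∃ λ js → All (λ j → P j (x j)) js × SpanL (List.map x js) v
    Span⇒list span-zero = [] , [] , combo [] refl
    Span⇒list (span-step c (j , refl , p) s) with Span⇒list s
    ... | js , ps , combo cs refl = j ∷ js , p ∷ ps , combo (c ∷ cs) refl

    module Extend {J : List I} (st : State J) (e : I) where

      open State st

      z : V n
      z = diag s (y e)

      -- If `x e` is in the kernel, it is spanned by elements of `J` there, and `y e` is spanned by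
      -- the same elements. Applying `diag s` takes each `y j` to a multiple of `x j`, so `z` is in
      -- the kernel as well. The converse runs backwards.
      same-kernel : ∀ {C a b} (cc : Cocircuit J label C a b) →
        (f cc (x e) ≡ 0ᶠ → f cc z ≡ 0ᶠ) × (f cc z ≡ 0ᶠ → f cc (x e) ≡ 0ᶠ)
      same-kernel cc = forward , backward
        where
        fun : Functional (f cc)
        fun = functional cc
        listed : ∀ {v} → f cc v ≡ 0ᶠ →
          ∃ λ js → All (λ j → j ∈ J × f cc (x j) ≡ 0ᶠ) js × SpanL (List.map x js) v
        listed eq = Span⇒list (Span-mono (λ (j , j∈ , xj , fw) → j , xj , j∈ , fw) (kernel-spanned cc eq))
        forward : f cc (x e) ≡ 0ᶠ → f cc z ≡ 0ᶠ
        forward eq with listed eq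
        ... | js , in-kernel , xe∈ =
          SpanL-least (preimage-kernel) (Allₚ.map⁺ (All.map generator in-kernel)) (closure e js xe∈)
          where
          preimage-kernel : Subspace (λ w → f cc (diag s w) ≡ 0ᶠ)
          preimage-kernel = preimage-subspace (diag-linear s) (kernel fun)
          generator : ∀ {j} → j ∈ J × f cc (x j) ≡ 0ᶠ → f cc (diag s (y j)) ≡ 0ᶠ
          generator {j} (j∈ , fxj) with scaled j∈
          ... | c , _ , eq rewrite eq = preimage-kernel .scale∈ c
                (trans (cong (f cc) (diag-involutive s≢0 (x j))) fxj)
        backward : f cc z ≡ 0ᶠ → f cc (x e) ≡ 0ᶠ
        backward eq with listed eq
        ... | js , in-kernel , z∈ = SpanL-least (kernel fun) (Allₚ.map⁺ (All.map proj₂ in-kernel))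
          (closure⁻ e js (subst (SpanL (List.map y js)) (diag-involutive s≢0 (y e))
            (SpanL-least (preimage-subspace (diag-linear s) SpanL-subspace)
              (Allₚ.map⁺ (All.tabulate λ j∈ → generator (proj₁ (All.lookup in-kernel j∈)) (∈-map⁺ y j∈))) z∈)))
          where
          generator : ∀ {j} → j ∈ J → y j ∈ List.map y js → SpanL (List.map y js) (diag s (x j))
          generator j∈ yj∈ with scaled j∈
          ... | c , c≢0 , eq =
            unscale∈ SpanL-subspace c≢0 (subst (SpanL _) eq (∈⇒SpanL yj∈))

      a b : V n
      a = x e ⊕ z
      b = x e ⊕ -1ᶠ ⊙ z

      -- Otherwise one cocircuit functional would be nonzero on both the sum and the difference of
      -- `x e` and `z`, contrary to `±-equal`.
      a-or-b : ∀ i l → label i ≡ label l → a ! i ≡ 0ᶠ ⊎ b ! l ≡ 0ᶠ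
      a-or-b i l same with a ! i ≟ 0ᶠ | b ! l ≟ 0ᶠ
      ... | yes ai | _ = inj₁ ai
      ... | no _ | yes bl = inj₂ bl
      ... | no ai≢0 | no bl≢0 = [ (λ eq → contradiction (trans (f-⊕ fun (x e) z) eq) (fa≢0 cc))
                                , (λ eq → contradiction (trans (f-⊕ fun (x e) _)
                                    (trans (cong (f cc (x e) +ᶠ_) (f-⊙ fun -1ᶠ z)) eq)) (fb≢0 cc)) ]′
                                (±-equal (f cc (x e)) (f cc z) (same-kernel cc))
        where
        cc : Cocircuit J label (label i) a b
        cc = cocircuit a b i l ai≢0 bl≢0 same
        fun : Functional (f cc)
        fun = functional cc

      flipped? : ∀ C → Dec (∃ λ l → label l ≡ C × b ! l ≢ 0ᶠ)
      flipped? C = Finₚ.any? λ l → (label l ≟ C) ×-dec ¬? (b ! l ≟ 0ᶠ)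

      -- If `z` and `x e` differ anywhere on a class, then `a-or-b` makes them opposite on all of
      -- it; otherwise they agree there.
      sign : Fin n → 𝔽
      sign C with flipped? C
      ... | yes _ = -1ᶠ
      ... | no _ = 1ᶠ

      sign≢0 : ∀ C → sign C ≢ 0ᶠ
      sign≢0 C with flipped? C
      ... | yes _ = -1≢0
      ... | no _ = 1≢0 F

      z-sign : ∀ i → sign (label i) · x e ! i ≡ z ! i
      z-sign i with flipped? (label i)
      ... | yes (l , same , bl≢0) = sym (+≡0⇒≡neg _ _
            (trans (sym (lookup-⊕ (x e) z i)) ([ id , (λ bl → contradiction bl bl≢0) ]′ (a-or-b i l (sym same)))))
      ... | no ∄l = trans (·-identityˡ F _) (sym (-≡0⇒≡ _ _
            (trans (cong (x e ! i +ᶠ_) (sym (lookup-⊙ -1ᶠ z i))) (trans (sym (lookup-⊕ (x e) _ i))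
              (decidable-stable (b ! i ≟ 0ᶠ) (λ bi≢0 → ∄l (i , refl , bi≢0)))))))

      t s′ : V n
      t = Vec.tabulate (sign ∘ label)
      s′ = diag s t

      lookup-t : ∀ i → t ! i ≡ sign (label i)
      lookup-t = Vecₚ.lookup∘tabulate (sign ∘ label)

      s′≢0 : NonzeroEntries s′
      s′≢0 i eq = ·-nonzero (s≢0 i) (sign≢0 (label i))
        (trans (cong (s ! i ·_) (sym (lookup-t i))) (trans (sym (lookup-diag s t i)) eq))

      scaled′ : ∀ {j} → j ∈ e ∷ J → ∃ λ c → c ≢ 0ᶠ × y j ≡ c ⊙ diag s′ (x j)
      scaled′ (here refl) = 1ᶠ , 1≢0 F , sym (begin
        1ᶠ ⊙ diag s′ (x e)      ≡⟨ ⊙-identity _ ⟩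
        diag (diag s t) (x e)   ≡⟨ diag-diag s t (x e) ⟩
        diag s (diag t (x e))   ≡⟨ cong (diag s) (lookup-ext λ i → trans (lookup-diag t (x e) i)
                                     (trans (cong (_· x e ! i) (lookup-t i)) (z-sign i))) ⟩
        diag s z                ≡⟨ diag-involutive s≢0 (y e) ⟩
        y e ∎)
        where open ≡-Reasoning
      -- The support of an older element lies in one class, where `t` is constant, so the sign
      -- change only rescales it.
      scaled′ {j} (there j∈) with scaled j∈ | in-class j∈
      ... | c , c≢0 , eq | C , class = c · sign C , ·-nonzero c≢0 (sign≢0 C) , (begin
        y j                                            ≡⟨ eq ⟩
        c ⊙ diag s (x j)                               ≡⟨ cong (c ⊙_) (sym (⊙-involutive _ (sign≢0 C))) ⟩
        c ⊙ sign C ⊙ sign C ⊙ diag s (x j)             ≡⟨ ⊙-assoc c (sign C) _ ⟩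
        (c · sign C) ⊙ sign C ⊙ diag s (x j)           ≡⟨ cong ((c · sign C) ⊙_) (sym (⊙-homo (diag-linear s) (sign C) _)) ⟩
        (c · sign C) ⊙ diag s (sign C ⊙ x j)           ≡⟨ cong (λ v → (c · sign C) ⊙ diag s v) (lookup-ext entry) ⟩
        (c · sign C) ⊙ diag s (diag t (x j))           ≡⟨ cong ((c · sign C) ⊙_) (sym (diag-diag s t (x j))) ⟩
        (c · sign C) ⊙ diag s′ (x j) ∎)
        where
        open ≡-Reasoning
        entry : ∀ i → (sign C ⊙ x j) ! i ≡ diag t (x j) ! i
        entry i = trans (lookup-⊙ (sign C) (x j) i) (sym (trans (lookup-diag t (x j) i)
          (trans (cong (_· x j ! i) (lookup-t i)) (same-sign (x j ! i ≟ 0ᶠ)))))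
          where
          same-sign : Dec (x j ! i ≡ 0ᶠ) → sign (label i) · x j ! i ≡ sign C · x j ! i
          same-sign (yes eq) rewrite eq = trans (·-zeroʳ F _) (sym (·-zeroʳ F _))
          same-sign (no nz) = cong (λ C → sign C · x j ! i) (class i nz)

      Meets : Fin n → Set
      Meets C = ∃ λ k → label k ≡ C × x e ! k ≢ 0ᶠ

      meets? : Decidable Meets
      meets? C = Finₚ.any? λ k → (label k ≟ C) ×-dec ¬? (x e ! k ≟ 0ᶠ)

      C₀ : Fin n
      C₀ = label (proj₁ (nonzero-entry (x e) (x≢0 e)))

      C₀-meets : Meets C₀
      C₀-meets = let k , nz = nonzero-entry (x e) (x≢0 e) in k , refl , nz

      -- The new element joins all components that its support meets; the joined component is named
      -- `C₀`.
      merge : Fin n → Fin n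
      merge C with meets? C
      ... | yes _ = C₀
      ... | no _ = C

      merge-meets : ∀ {C} → Meets C → merge C ≡ C₀
      merge-meets {C} m with meets? C
      ... | yes _ = refl
      ... | no ¬m = contradiction m ¬m

      merge-≡ : ∀ {C D} → merge C ≡ merge D → C ≡ D ⊎ Meets C × Meets D
      merge-≡ {C} {D} eq with meets? C | meets? D
      ... | yes mC | yes mD = inj₂ (mC , mD)
      ... | yes _ | no ¬mD = contradiction (subst Meets eq C₀-meets) ¬mD
      ... | no ¬mC | yes _ = contradiction (subst Meets (sym eq) C₀-meets) ¬mC
      ... | no _ | no _ = inj₁ eq

      label′ : Fin n → Fin n
      label′ = merge ∘ label

      in-class′ : ∀ {j} → j ∈ e ∷ J → ∃ λ C → ∀ i → x j ! i ≢ 0ᶠ → label′ i ≡ C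
      in-class′ (here refl) = C₀ , λ i nz → merge-meets (i , refl , nz)
      in-class′ (there j∈) with in-class j∈
      ... | C , class = merge C , λ i nz → cong merge (class i nz)

      -- Classes only grow and elements are only added, so the old functional still serves.
      weaken : ∀ {C a b} → Cocircuit J label C a b → Cocircuit (e ∷ J) label′ (merge C) a b
      weaken cc = record
        { f = f cc
        ; functional = functional cc
        ; fa≢0 = fa≢0 cc
        ; fb≢0 = fb≢0 cc
        ; support = λ van → support cc (λ k eq → van k (cong merge eq))
        ; kernel-spanned = λ eq → Span-mono (λ (j , j∈ , rest) → j , there j∈ , rest) (kernel-spanned cc eq)
        }

      indicator : Fin n → Fin n → 𝔽
      indicator C k with label k ≟ C
      ... | yes _ = 1ᶠ
      ... | no _ = 0ᶠ

      project : Fin n → V n → V n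
      project C = diag (Vec.tabulate (indicator C))

      project-linear : ∀ C → Linear (project C)
      project-linear C = diag-linear (Vec.tabulate (indicator C))

      lookup-project : ∀ C v k → project C v ! k ≡ indicator C k · v ! k
      lookup-project C v k = trans (lookup-diag (Vec.tabulate (indicator C)) v k)
        (cong (_· v ! k) (Vecₚ.lookup∘tabulate (indicator C) k))

      project-inside : ∀ {C k} v → label k ≡ C → project C v ! k ≡ v ! k
      project-inside {C} {k} v eq with label k ≟ C | lookup-project C v k
      ... | yes _ | lp = trans lp (·-identityˡ F _)
      ... | no neq | _ = contradiction eq neq

      project-outside : ∀ {C k} v → label k ≢ C → project C v ! k ≡ 0ᶠ
      project-outside {C} {k} v neq with label k ≟ C | lookup-project C v k
      ... | yes eq | _ = contradiction eq neq
      ... | no _ | lp = trans lp (·-zeroˡ F _)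

      -- With f and g cocircuit functionals on two components merged by e, the functional
      -- h = g(x e) f − f(x e) g vanishes on x e, and its kernel is spanned by x e and the
      -- common kernel of f and g.
      combine : ∀ {C D a b} → C ≢ D → Meets C → Meets D → Vanishes label D a → Vanishes label C b →
        Cocircuit J label C a (x e) → Cocircuit J label D b (x e) → Cocircuit (e ∷ J) label′ C₀ a b
      combine {C} {D} {a} {b} C≢D mC mD a-van b-van cc dd = record
        { f = h
        ; functional = h-fun
        ; fa≢0 = λ eq → ·-nonzero (fb≢0 dd) (fa≢0 cc) (trans (sym (h-left (support dd a-van))) eq)
        ; fb≢0 = λ eq → ·-nonzero (·-nonzero -1≢0 (fb≢0 cc)) (fa≢0 dd)
            (trans (sym (h-right (support cc b-van))) eq)
        ; support = λ van → h-zero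
            (support cc (λ k eq → van k (trans (cong merge eq) (merge-meets mC))))
            (support dd (λ k eq → van k (trans (cong merge eq) (merge-meets mD))))
        ; kernel-spanned = kernel-spanned′
        }
        where
        f₁ f₂ h : V n → 𝔽
        f₁ = f cc
        f₂ = f dd
        ε₁ ε₂ : 𝔽
        ε₁ = f₁ (x e)
        ε₂ = f₂ (x e)
        h v = ε₂ · f₁ v +ᶠ (-1ᶠ · ε₁) · f₂ v
        h-left : ∀ {v} → f₂ v ≡ 0ᶠ → h v ≡ ε₂ · f₁ v
        h-left {v} eq rewrite eq = trans (cong (ε₂ · f₁ v +ᶠ_) (·-zeroʳ F _))
          (trans (+ᶠ-comm F _ 0ᶠ) (+ᶠ-identityˡ F _))
        h-right : ∀ {v} → f₁ v ≡ 0ᶠ → h v ≡ (-1ᶠ · ε₁) · f₂ v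
        h-right {v} eq rewrite eq = trans (cong (_+ᶠ (-1ᶠ · ε₁) · f₂ v) (·-zeroʳ F _)) (+ᶠ-identityˡ F _)
        h-zero : ∀ {v} → f₁ v ≡ 0ᶠ → f₂ v ≡ 0ᶠ → h v ≡ 0ᶠ
        h-zero {v} eq₁ eq₂ = trans (h-left eq₂) (trans (cong (ε₂ ·_) eq₁) (·-zeroʳ F _))
        h-fun : Functional h
        h-fun .f-⊕ v w rewrite functional cc .f-⊕ v w | functional dd .f-⊕ v w =
          combination-+ F ε₂ (-1ᶠ · ε₁) (f₁ v) (f₁ w) (f₂ v) (f₂ w)
        h-fun .f-⊙ c v rewrite functional cc .f-⊙ c v | functional dd .f-⊙ c v =
          combination-· F ε₂ (-1ᶠ · ε₁) c (f₁ v) (f₂ v)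
        K : V n → Set
        K w = ∃ λ j → j ∈ e ∷ J × x j ≡ w × h w ≡ 0ᶠ
        -- Each x j lies in a single class, so the projection either keeps it or kills it.
        push-project : ∀ E (f′ : V n → 𝔽) →
          (∀ {w} → f′ w ≡ 0ᶠ → (∀ i → w ! i ≢ 0ᶠ → label i ≡ E) → h w ≡ 0ᶠ) →
          ∀ {v} → Span (λ w → ∃ λ j → j ∈ J × x j ≡ w × f′ w ≡ 0ᶠ) v → Span K (project E v)
        push-project E f′ h-vanishes =
          Span-least (preimage-subspace (project-linear E) Span-subspace) generator
          where
          generator : ∀ {w} → (∃ λ j → j ∈ J × x j ≡ w × f′ w ≡ 0ᶠ) → Span K (project E w)
          generator (j , j∈ , refl , f′≡0) with in-class j∈
          ... | C′ , class with C′ ≟ E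
          ...   | yes refl = subst (Span K) (sym (lookup-ext kept))
                  (⊆Span (j , there j∈ , refl , h-vanishes f′≡0 class))
            where
            kept : ∀ i → project E (x j) ! i ≡ x j ! i
            kept i with label i ≟ E
            ... | yes eq = project-inside (x j) eq
            ... | no neq = trans (project-outside (x j) neq)
                  (sym (decidable-stable (x j ! i ≟ 0ᶠ) (λ nz → neq (class i nz))))
          ...   | no C′≢E = subst (Span K) (sym (lookup-ext killed)) span-zero
            where
            killed : ∀ i → project E (x j) ! i ≡ 𝟘 ! i
            killed i with label i ≟ E
            ... | no neq = trans (project-outside (x j) neq) (sym (lookup-𝟘 i))
            ... | yes eq = trans (project-inside (x j) eq) (trans
                  (decidable-stable (x j ! i ≟ 0ᶠ) (λ nz → C′≢E (trans (sym (class i nz)) eq)))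
                  (sym (lookup-𝟘 i)))
        other-class : ∀ {w E E′} → E ≢ E′ → (∀ i → w ! i ≢ 0ᶠ → label i ≡ E) → Vanishes label E′ w
        other-class {w} E≢E′ class i eq =
          decidable-stable (w ! i ≟ 0ᶠ) (λ nz → E≢E′ (trans (sym (class i nz)) eq))
        -- Split `v` into its parts on `C`, on `D` and on the remaining coordinates. The spanning
        -- properties of `f₁` and `f₂` handle the first two; the third is spanned by basis elements
        -- on which both functionals vanish.
        common-kernel : ∀ {v} → f₁ v ≡ 0ᶠ → f₂ v ≡ 0ᶠ → Span K v
        common-kernel {v} eq₁ eq₂ = subst (Span K) (lookup-ext total)
          (add∈ Span-subspace
            (add∈ Span-subspace
              (push-project C f₁ (λ {w} eq class → h-zero eq (support dd (other-class {w} C≢D class)))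
                (kernel-spanned cc eq₁))
              (push-project D f₂ (λ {w} eq class → h-zero (support cc (other-class {w} (C≢D ∘ sym) class)) eq)
                (kernel-spanned dd eq₂)))
            (unit-induction Span-subspace rest rest-entry))
          where
          p rest : V n
          p = project C v ⊕ project D v
          rest = v ⊕ -1ᶠ ⊙ p
          total : ∀ i → (p ⊕ rest) ! i ≡ v ! i
          total i = cong (_! i) (trans (⊕-comm p rest) (⊖-cancelʳ v p))
          p-inside : ∀ i → label i ≡ C ⊎ label i ≡ D → p ! i ≡ v ! i
          p-inside i (inj₁ eq) = trans (lookup-⊕ (project C v) (project D v) i) (trans
            (cong₂ _+ᶠ_ (project-inside v eq) (project-outside v (λ eq′ → C≢D (trans (sym eq) eq′))))
            (trans (+ᶠ-comm F _ 0ᶠ) (+ᶠ-identityˡ F _)))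
          p-inside i (inj₂ eq) = trans (lookup-⊕ (project C v) (project D v) i) (trans
            (cong₂ _+ᶠ_ (project-outside v (λ eq′ → C≢D (trans (sym eq′) eq))) (project-inside v eq))
            (+ᶠ-identityˡ F _))
          rest-entry : ∀ i → rest ! i ≡ 0ᶠ ⊎ Span K (unit i)
          rest-entry i with (label i ≟ C) ⊎-dec (label i ≟ D)
          ... | yes eq = inj₁ (trans (lookup-⊕ v _ i) (trans
                (cong (v ! i +ᶠ_) (trans (lookup-⊙ -1ᶠ p i) (cong (-1ᶠ ·_) (p-inside i eq))))
                (+ᶠ-inverseʳ F _)))
          ... | no neither = inj₂ (⊆Span (u i , there (u∈ i) , x-u i , h-zero
                (support cc (λ k eq → lookup-unit-≢ {i = k} {i} (λ { refl → neither (inj₁ eq) })))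
                (support dd (λ k eq → lookup-unit-≢ {i = k} {i} (λ { refl → neither (inj₂ eq) })))))
        kernel-spanned′ : ∀ {v} → h v ≡ 0ᶠ → Span K v
        kernel-spanned′ {v} hv≡0 = sub∈ Span-subspace
          (common-kernel
            (trans (f-shift cc) (elimination F (f₁ v) ε₁ (fb≢0 cc)))
            (trans (f-shift dd) (elimination′ F ε₁ ε₂ (f₁ v) (f₂ v) (fb≢0 cc) hv≡0)))
          (scale∈ Span-subspace c (⊆Span (e , here refl , refl , hxe≡0)))
          where
          -- Adding this multiple of `x e` brings `v` into the kernel of `f₁`, and also into that of
          -- `f₂` because `h v` is zero.
          c : 𝔽
          c = -1ᶠ · (ε₁ · f₁ v)
          f-shift : ∀ {C b} (cc : Cocircuit J label C b (x e)) → f cc (v ⊕ c ⊙ x e) ≡ f cc v +ᶠ c · f cc (x e)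
          f-shift cc = trans (functional cc .f-⊕ v _) (cong (f cc v +ᶠ_) (functional cc .f-⊙ c (x e)))
          hxe≡0 : h (x e) ≡ 0ᶠ
          hxe≡0 = antisymmetric F ε₁ ε₂

      -- An old functional serves if the old classes of `i` and `l` agree, if `a` is nonzero on the
      -- class of `l`, or if `b` is nonzero on that of `i`. Otherwise each vector vanishes on the
      -- other's class, and two functionals that also detect `x e` are combined.
      cocircuit′ : ∀ a b i l → a ! i ≢ 0ᶠ → b ! l ≢ 0ᶠ → label′ i ≡ label′ l →
        Cocircuit (e ∷ J) label′ (label′ i) a b
      cocircuit′ a b i l ai≢0 bl≢0 same′ with merge-≡ same′
      ... | inj₁ same = weaken (cocircuit a b i l ai≢0 bl≢0 same)
      ... | inj₂ (mi@(i′ , i′≡ , xi′) , ml@(l′ , l′≡ , xl′))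
        with label i ≟ label l
           | Finₚ.any? (λ m → (label m ≟ label l) ×-dec ¬? (a ! m ≟ 0ᶠ))
           | Finₚ.any? (λ m → (label m ≟ label i) ×-dec ¬? (b ! m ≟ 0ᶠ))
      ... | yes same | _ | _ = weaken (cocircuit a b i l ai≢0 bl≢0 same)
      ... | no _ | yes (m , m≡ , am≢0) | _ =
        subst (λ C → Cocircuit (e ∷ J) label′ C a b) (trans (cong merge m≡) (sym same′))
          (weaken (cocircuit a b m l am≢0 bl≢0 m≡))
      ... | no _ | no _ | yes (m , m≡ , bm≢0) = weaken (cocircuit a b i m ai≢0 bm≢0 (sym m≡))
      ... | no i≢l | no ∄a | no ∄b =
        subst (λ C → Cocircuit (e ∷ J) label′ C a b) (sym (merge-meets mi))
          (combine i≢l mi ml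
            (λ k eq → decidable-stable (a ! k ≟ 0ᶠ) (λ nz → ∄a (k , eq , nz)))
            (λ k eq → decidable-stable (b ! k ≟ 0ᶠ) (λ nz → ∄b (k , eq , nz)))
            (cocircuit a (x e) i i′ ai≢0 xi′ (sym i′≡))
            (cocircuit b (x e) l l′ bl≢0 xl′ (sym l′≡)))

      extended : State (e ∷ J)
      extended = record
        { label = label′
        ; s = s′
        ; s≢0 = s′≢0
        ; scaled = scaled′
        ; in-class = in-class′
        ; u∈ = there ∘ u∈
        ; cocircuit = cocircuit′
        }

    state : ∀ es → State (es ++ List.tabulate u)
    state [] = initial
    state (e ∷ es) = Extend.extended (state es) e

    scaled-diagonally : ∀ es → ∃ λ s → NonzeroEntries s ×
      (∀ {e} → e ∈ es → ∃ λ c → c ≢ 0ᶠ × y e ≡ c ⊙ diag s (x e))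
    scaled-diagonally es = State.s (state es) , State.s≢0 (state es) ,
      λ e∈ → State.scaled (state es) (∈-++⁺ˡ e∈)

-- Direct sums on complementary coordinate blocks.

module DirectSums (F : Field) where

  open Linear F
  open Colourings F
  open Points F

  take-linear : ∀ k {l} → Linear (Vec.take k {l})
  take-linear k .+-homo u v = Vecₚ.take-zipWith _+ᶠ_ u v
  take-linear k .⊙-homo c v = Vecₚ.take-map (c ·_) k v

  drop-linear : ∀ k {l} → Linear (Vec.drop k {l})
  drop-linear k .+-homo u v = Vecₚ.drop-zipWith {m = k} _+ᶠ_ u v
  drop-linear k .⊙-homo c v = Vecₚ.drop-map (c ·_) k v

  inl : ∀ {k} l → V k → V (k ℕ.+ l)
  inl l u = u Vec.++ 𝟘

  inr : ∀ k {l} → V l → V (k ℕ.+ l)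
  inr k w = 𝟘 {k} Vec.++ w

  inl-linear : ∀ {k} l → Linear (inl {k} l)
  inl-linear l .+-homo u v =
    sym (trans (Vecₚ.zipWith-++ _+ᶠ_ u 𝟘 v 𝟘) (cong ((u ⊕ v) Vec.++_) (⊕-identityˡ 𝟘)))
  inl-linear l .⊙-homo c v =
    sym (trans (Vecₚ.map-++ (c ·_) v 𝟘) (cong ((c ⊙ v) Vec.++_) (⊙-zeroʳ c)))

  inr-linear : ∀ k {l} → Linear (inr k {l})
  inr-linear k .+-homo u v =
    sym (trans (Vecₚ.zipWith-++ _+ᶠ_ (𝟘 {k}) u 𝟘 v) (cong (Vec._++ (u ⊕ v)) (⊕-identityˡ 𝟘)))
  inr-linear k .⊙-homo c v =
    sym (trans (Vecₚ.map-++ (c ·_) (𝟘 {k}) v) (cong (Vec._++ (c ⊙ v)) (⊙-zeroʳ c)))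

  take-++ : ∀ {k l} (u : V k) (w : V l) → Vec.take k (u Vec.++ w) ≡ u
  take-++ {k} u w = Vecₚ.++-injectiveˡ _ _ (Vecₚ.take++drop≡id k (u Vec.++ w))

  drop-++ : ∀ {k l} (u : V k) (w : V l) → Vec.drop k (u Vec.++ w) ≡ w
  drop-++ {k} u w = Vecₚ.++-injectiveʳ (Vec.take k (u Vec.++ w)) u (Vecₚ.take++drop≡id k (u Vec.++ w))

  inl-kernel : ∀ {k} l → TrivialKernel (inl {k} l)
  inl-kernel {k} l u eq = trans (sym (take-++ u 𝟘)) (trans (cong (Vec.take k) eq) (0-homo (take-linear k)))

  inr-kernel : ∀ k {l} → TrivialKernel (inr k {l})
  inr-kernel k w eq = trans (sym (drop-++ (𝟘 {k}) w)) (trans (cong (Vec.drop k) eq) (0-homo (drop-linear k)))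

  drop≡0⇒inl : ∀ k {l} {v : V (k ℕ.+ l)} → Vec.drop k v ≡ 𝟘 → inl l (Vec.take k v) ≡ v
  drop≡0⇒inl k {v = v} eq = trans (cong (Vec.take k v Vec.++_) (sym eq)) (Vecₚ.take++drop≡id k v)

  take≡0⇒inr : ∀ k {l} {v : V (k ℕ.+ l)} → Vec.take k v ≡ 𝟘 → inr k (Vec.drop k v) ≡ v
  take≡0⇒inr k {v = v} eq = trans (cong (Vec._++ Vec.drop k v) (sym eq)) (Vecₚ.take++drop≡id k v)

  take,drop≡0 : ∀ k {l} {v : V (k ℕ.+ l)} → Vec.take k v ≡ 𝟘 → Vec.drop k v ≡ 𝟘 → v ≡ 𝟘
  take,drop≡0 k eq₁ eq₂ = trans (sym (drop≡0⇒inl k eq₂))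
    (trans (cong (inl _) eq₁) (0-homo (inl-linear {k} _)))

  isZeroV-𝟘 : ∀ k → isZeroV (𝟘 {k}) ≡ true
  isZeroV-𝟘 zero = refl
  isZeroV-𝟘 (suc k) rewrite isZ-0 = isZeroV-𝟘 k

  isZeroV-≢0 : ∀ {k} (v : V k) → v ≢ 𝟘 → isZeroV v ≡ false
  isZeroV-≢0 [] v≢0 = contradiction refl v≢0
  isZeroV-≢0 (x ∷ v) v≢0 with x ≟ 0ᶠ
  ... | yes refl rewrite isZ-0 = isZeroV-≢0 v (v≢0 ∘ cong (0ᶠ ∷_))
  ... | no x≢0 rewrite isZ-≢0 x x≢0 = refl

  -- The leading entry is found in the first block unless that block is zero, so normalising a
  -- vector normalises this block.
  lead-take : ∀ k {l} (v : V (k ℕ.+ l)) → Vec.take k v ≢ 𝟘 → lead v ≡ lead (Vec.take k v)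
  lead-take zero v nz = contradiction refl nz
  lead-take (suc k) (x ∷ v) nz with x ≟ 0ᶠ
  ... | yes refl = lead-take k v (nz ∘ cong (0ᶠ ∷_))
  ... | no _ = refl

  lead-drop : ∀ k {l} (v : V (k ℕ.+ l)) → Vec.take k v ≡ 𝟘 → lead v ≡ lead (Vec.drop k v)
  lead-drop zero v _ = refl
  lead-drop (suc k) (x ∷ v) eq with x ≟ 0ᶠ
  ... | yes _ = lead-drop k v (Vecₚ.∷-injectiveʳ eq)
  ... | no x≢0 = contradiction (Vecₚ.∷-injectiveˡ eq) x≢0

  module _ {k l} (T : PSet F k) (U : PSet F l) where

    private
      D : PSet F (k ℕ.+ l)
      D = dsumSet T U

    colour-dsum : ∀ {v} → v ≢ 𝟘 → colour D v ≡
      (isZeroV (lead v ⊙ Vec.drop k v) ∧ memV T (lead v ⊙ Vec.take k v)) ∨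
      (isZeroV (lead v ⊙ Vec.take k v) ∧ memV U (lead v ⊙ Vec.drop k v))
    colour-dsum {v} v≢0 = trans (colour-toPt D v≢0)
      (cong₂ (λ u w → (isZeroV w ∧ memV T u) ∨ (isZeroV u ∧ memV U w))
        (⊙-homo (take-linear k) (lead v) v) (⊙-homo (drop-linear k) (lead v) v))

    colour-left : ∀ {v} → v ≢ 𝟘 → Vec.drop k v ≡ 𝟘 → colour D v ≡ colour T (Vec.take k v)
    colour-left {v} v≢0 eq rewrite colour-dsum v≢0 | eq | ⊙-zeroʳ {l} (lead v) | isZeroV-𝟘 l
      | isZeroV-≢0 _ (⊙-nonzero (lead≢0 v) (λ take≡0 → v≢0 (take,drop≡0 k take≡0 eq)))
      | lead-take k v (λ take≡0 → v≢0 (take,drop≡0 k take≡0 eq)) = Boolₚ.∨-identityʳ _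

    colour-right : ∀ {v} → v ≢ 𝟘 → Vec.take k v ≡ 𝟘 → colour D v ≡ colour U (Vec.drop k v)
    colour-right {v} v≢0 eq rewrite colour-dsum v≢0 | lead-drop k v eq | eq
      | ⊙-zeroʳ {k} (lead (Vec.drop k v)) | isZeroV-𝟘 k
      | isZeroV-≢0 _ (⊙-nonzero (lead≢0 (Vec.drop k v)) (λ drop≡0 → v≢0 (take,drop≡0 k eq drop≡0))) = refl

    colour-mixed : ∀ {v} → Vec.take k v ≢ 𝟘 → Vec.drop k v ≢ 𝟘 → colour D v ≡ false
    colour-mixed {v} take≢0 drop≢0
      rewrite colour-dsum {v} (λ { refl → take≢0 (0-homo (take-linear k)) })
        | isZeroV-≢0 _ (⊙-nonzero (lead≢0 v) take≢0) | isZeroV-≢0 _ (⊙-nonzero (lead≢0 v) drop≢0) = refl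

    left-or-right : ∀ {v} → colour D v ≡ true → Vec.take k v ≡ 𝟘 ⊎ Vec.drop k v ≡ 𝟘
    left-or-right {v} v∈ with Vec.take k v ≟ᵛ 𝟘 | Vec.drop k v ≟ᵛ 𝟘
    ... | yes eq | _ = inj₁ eq
    ... | no _ | yes eq = inj₂ eq
    ... | no take≢0 | no drop≢0 with trans (sym v∈) (colour-mixed take≢0 drop≢0)
    ...   | ()

    colour-inl : ∀ u → u ≢ 𝟘 → colour D (inl l u) ≡ colour T u
    colour-inl u u≢0 = trans (colour-left (u≢0 ∘ inl-kernel l u) (drop-++ u 𝟘)) (cong (colour T) (take-++ u 𝟘))

    colour-inr : ∀ w → w ≢ 𝟘 → colour D (inr k w) ≡ colour U w
    colour-inr w w≢0 = trans (colour-right (w≢0 ∘ inr-kernel k w) (take-++ (𝟘 {k}) w)) (cong (colour U) (drop-++ (𝟘 {k}) w))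

    -- If the class `true` in `W` lies in one block, `Goodᵂ-push` applies to the inclusion of that
    -- block. If it meets both, its two parts form a separation.
    Good-dsum : Good (colour T) → Good (colour U) → Good (colour D)
    Good-dsum goodT goodU W W? sub nz same
      with ∃ᵛ? (λ v → Mono? (colour D) true W? v ×-dec (Vec.drop k v ≟ᵛ 𝟘))
         | ∃ᵛ? (λ v → Mono? (colour D) true W? v ×-dec (Vec.take k v ≟ᵛ 𝟘))
    ... | no ∄left | _ = Goodᵂ-push (inr-linear k) (inr-kernel k) {χ′ = colour U} {χ = colour D} colour-inr goodU W? sub nz
          (λ {v} v∈ → Vec.drop k v , take≡0⇒inr k
            ([ id , (λ eq → contradiction (v , v∈ , eq) ∄left) ]′ (left-or-right (proj₂ (proj₂ v∈))))) same
    ... | yes _ | no ∄right = Goodᵂ-push (inl-linear l) (inl-kernel l) {χ′ = colour T} {χ = colour D} colour-inl goodT W? sub nz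
          (λ {v} v∈ → Vec.take k v , drop≡0⇒inl k
            ([ (λ eq → contradiction (v , v∈ , eq) ∄right) , id ]′ (left-or-right (proj₂ (proj₂ v∈))))) same
    ... | yes (v₁ , v₁∈ , drop≡0) | yes (v₂ , v₂∈ , take≡0) = inj₁ record
      { A = λ v → Mono (colour D) true W v × Vec.drop k v ≡ 𝟘
      ; A? = λ v → Mono? (colour D) true W? v ×-dec (Vec.drop k v ≟ᵛ 𝟘)
      ; A⊆ = proj₁
      ; A-nonempty = v₁ , v₁∈ , drop≡0
      ; rest-nonempty = v₂ , v₂∈ , λ (_ , eq) → proj₁ (proj₂ v₂∈) (take,drop≡0 k take≡0 eq)
      ; meet-trivial = λ s t → take,drop≡0 k
          (Span-least (preimage-subspace (take-linear k) zero-subspace)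
            (λ (v∈ , ¬left) → [ id , (λ eq → contradiction (v∈ , eq) ¬left) ]′ (left-or-right (proj₂ (proj₂ v∈)))) t)
          (Span-least (preimage-subspace (drop-linear k) zero-subspace) proj₂ s)
      }
      where
      zero-subspace : ∀ {m} → Subspace {m} (_≡ 𝟘)
      zero-subspace .zero∈ = refl
      zero-subspace .add∈ refl refl = ⊕-identityˡ 𝟘
      zero-subspace .scale∈ c refl = ⊙-zeroʳ c

-- Invariance of goodness under matroid isomorphism.

module Isomorphisms (F : Field) where

  open Linear F
  open Colourings F
  open Points F
  open Uniqueness F

  module _ {A : Set} {k} (g : A → V k) where

    -- Coefficients are indexed by the elements `us` rather than by their vectors, so two
    -- representations share one coefficient space.
    combine-by : (us : List A) → V (length us) → V k
    combine-by [] [] = 𝟘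
    combine-by (e ∷ us) (c ∷ cs) = c ⊙ g e ⊕ combine-by us cs

    combine-by-linear : ∀ us → Linear (combine-by us)
    combine-by-linear [] .+-homo [] [] = sym (⊕-identityˡ 𝟘)
    combine-by-linear [] .⊙-homo c [] = sym (⊙-zeroʳ c)
    combine-by-linear (e ∷ us) .+-homo (c ∷ cs) (d ∷ ds) = trans
      (cong₂ _⊕_ (⊙-distribʳ c d (g e)) (combine-by-linear us .+-homo cs ds)) (⊕-interchange _ _ _ _)
    combine-by-linear (e ∷ us) .⊙-homo c (d ∷ ds) = trans
      (cong₂ _⊕_ (sym (⊙-assoc c d (g e))) (combine-by-linear us .⊙-homo c ds)) (sym (⊙-distribˡ c _ _))

    combine-by-SpanL : ∀ us cs → SpanL (List.map g us) (combine-by us cs)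
    combine-by-SpanL [] [] = zero∈ SpanL-subspace
    combine-by-SpanL (e ∷ us) (c ∷ cs) = add∈ SpanL-subspace
      (scale∈ SpanL-subspace c (∈⇒SpanL (here refl))) (SpanL-there (combine-by-SpanL us cs))

    SpanL⇒combine-by : ∀ us {v} → SpanL (List.map g us) v → ∃ λ cs → combine-by us cs ≡ v
    SpanL⇒combine-by [] (combo [] refl) = [] , refl
    SpanL⇒combine-by (e ∷ us) (combo (c ∷ cs) refl) with SpanL⇒combine-by us (combo cs refl)
    ... | cs′ , eq = c ∷ cs′ , cong (c ⊙ g e ⊕_) eq

    combine-by-kernel : ∀ us → Indep (List.map g us) → TrivialKernel (combine-by us)
    combine-by-kernel [] _ [] _ = refl
    combine-by-kernel (e ∷ us) (e∉ , ind) (c ∷ cs) eq with c ≟ 0ᶠ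
    ... | yes refl = cong (0ᶠ ∷_) (combine-by-kernel us ind cs (trans (sym (drop-zero (g e) _)) eq))
    ... | no c≢0 = contradiction
          (subst (SpanL (List.map g us)) (sym (isolate c≢0 eq))
            (add∈ SpanL-subspace (scale∈ SpanL-subspace c (zero∈ SpanL-subspace))
              (scale∈ SpanL-subspace (c · -1ᶠ) (combine-by-SpanL us cs))))
          e∉

    combine-by-unit : ∀ us i → combine-by us (unit i) ≡ g (List.lookup us i)
    combine-by-unit (e ∷ us) Fin.zero =
      trans (cong₂ _⊕_ (⊙-identity (g e)) (0-homo (combine-by-linear us))) (⊕-identityʳ (g e))
    combine-by-unit (e ∷ us) (Fin.suc i) = trans (drop-zero (g e) _) (combine-by-unit us i)

    extract-basis : ∀ es → ∃ λ us → (∀ {e} → e ∈ us → e ∈ es) × Indep (List.map g us) ×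
      (∀ {e} → e ∈ es → SpanL (List.map g us) (g e))
    extract-basis [] = [] , (λ ()) , tt , λ ()
    extract-basis (e ∷ es) with extract-basis es
    ... | us , us⊆ , ind , spans-es with SpanL? (List.map g us) (g e)
    ...   | yes e∈ = us , there ∘ us⊆ , ind , λ { (here refl) → e∈ ; (there p) → spans-es p }
    ...   | no e∉ = e ∷ us , (λ { (here eq) → here eq ; (there p) → there (us⊆ p) }) , (e∉ , ind) ,
            λ { (here refl) → ∈⇒SpanL (here refl) ; (there p) → SpanL-there (spans-es p) }

  -- Thin `es` to `us`, independent with the same span under `g`. If `h e` were outside the span of
  -- `us` under `h`, then `e ∷ us` would be independent under `h`, hence under `g`.
  closure-transfer : ∀ {A : Set} {k l} (g : A → V k) (h : A → V l) →
    (∀ es → Indep (List.map g es) → Indep (List.map h es)) →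
    (∀ es → Indep (List.map h es) → Indep (List.map g es)) →
    ∀ e es → SpanL (List.map g es) (g e) → SpanL (List.map h es) (h e)
  closure-transfer g h g⇒h h⇒g e es e∈ with extract-basis g es
  ... | us , us⊆ , ind , spans-es with SpanL? (List.map h us) (h e)
  ...   | yes p = SpanL-mono (∈-map-⊆ us⊆) p
    where
    ∈-map-⊆ : (∀ {e} → e ∈ us → e ∈ es) → ∀ {v} → v ∈ List.map h us → v ∈ List.map h es
    ∈-map-⊆ us⊆ v∈ with ∈-map⁻ h v∈
    ... | e , e∈ , refl = ∈-map⁺ h (us⊆ e∈)
  ...   | no h∉ = contradiction
          (SpanL-least SpanL-subspace (Allₚ.map⁺ (All.tabulate spans-es)) e∈)
          (proj₁ (h⇒g (e ∷ us) (h∉ , g⇒h us ind)))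

  allV : ∀ k → List (V k)
  allV zero = [] ∷ []
  allV (suc k) = List.cartesianProductWith _∷_ (List.allFin _) (allV k)

  ∈-allV : ∀ {k} (v : V k) → v ∈ allV k
  ∈-allV [] = here refl
  ∈-allV (x ∷ v) = ∈-cartesianProductWith⁺ _∷_ (∈-allFin x) (∈-allV v)

  elem-≡ : ∀ {k} {T : PSet F k} {e e′ : Elem T} → vecOf {T = T} e ≡ vecOf {T = T} e′ → e ≡ e′
  elem-≡ {e = (v , nv) , t} {(.v , nv′) , t′} refl with uip nv nv′
  ... | refl with uip t t′
  ...   | refl = refl

  module _ {k} (T : PSet F k) where

    elems : List (V k) → List (Elem T)
    elems [] = []
    elems (v ∷ vs) with norm? v ≟ᵇ true
    ... | no _ = elems vs
    ... | yes nv with T (v , nv) ≟ᵇ true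
    ...   | no _ = elems vs
    ...   | yes t = ((v , nv) , t) ∷ elems vs

    ∈-elems : ∀ {vs} (e : Elem T) → vecOf {T = T} e ∈ vs → e ∈ elems vs
    ∈-elems {v ∷ vs} e@((_ , nv) , t) v∈ with norm? v ≟ᵇ true
    ∈-elems {v ∷ vs} e@((_ , nv) , t) (here refl) | no ¬nv = contradiction nv ¬nv
    ∈-elems {v ∷ vs} e (there v∈) | no _ = ∈-elems e v∈
    ... | yes nv′ with T (v , nv′) ≟ᵇ true
    ∈-elems {v ∷ vs} e@((_ , nv) , t) (here refl) | yes nv′ | no ¬t =
      contradiction (trans (cong (λ n → T (v , n)) (uip nv′ nv)) t) ¬t
    ∈-elems {v ∷ vs} e (there v∈) | yes _ | no _ = ∈-elems e v∈
    ∈-elems {v ∷ vs} e (here eq) | yes _ | yes _ = here (elem-≡ {T = T} eq)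
    ∈-elems {v ∷ vs} e (there v∈) | yes _ | yes _ = there (∈-elems e v∈)

    allElems : List (Elem T)
    allElems = elems (allV k)

    ∈-allElems : ∀ e → e ∈ allElems
    ∈-allElems e = ∈-elems e (∈-allV _)

  bool-≡ : ∀ {a b} → (a ≡ true → b ≡ true) → (b ≡ true → a ≡ true) → a ≡ b
  bool-≡ {true} f _ = sym (f refl)
  bool-≡ {false} {false} _ _ = refl
  bool-≡ {false} {true} _ g = g refl

  -- Unique representability: matching `φ u` with `ψ u` is a linear correspondence that takes each
  -- `g e` to a nonzero multiple of `h e`.
  record CommonCoordinates {A : Set} {k l} (g : A → V k) (h : A → V l) : Set where
    field
      n : ℕ
      φ : V n → V k
      φ-linear : Linear φ
      φ-kernel : TrivialKernel φ
      ψ : V n → V l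
      ψ-linear : Linear ψ
      ψ-kernel : TrivialKernel ψ
      x : A → V n
      φ-x : ∀ e → φ (x e) ≡ g e
      ψ-x : ∀ e → ∃ λ c → c ≢ 0ᶠ × h e ≡ c ⊙ ψ (x e)

  preimages-scaled : ∀ {A : Set} {n m} {θ : V n → V m} (coords : A → V n) (vec : A → V m) →
    (∀ e → θ (coords e) ≡ vec e) → ∀ es → ScaledImage θ (List.map coords es) (List.map vec es)
  preimages-scaled coords vec eq [] = []
  preimages-scaled coords vec eq (e ∷ es) =
    (1ᶠ , 1≢0 F , trans (sym (eq e)) (sym (⊙-identity _))) ∷ preimages-scaled coords vec eq es

  closure-coords : ∀ {A : Set} {k l p q} (g : A → V k) (h : A → V l) {φ : V p → V k} {ψ : V q → V l} →
    Linear φ → Linear ψ → TrivialKernel ψ →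
    (x : A → V p) → (∀ e → φ (x e) ≡ g e) → (y : A → V q) → (∀ e → ψ (y e) ≡ h e) →
    (∀ e es → SpanL (List.map g es) (g e) → SpanL (List.map h es) (h e)) →
    ∀ e es → SpanL (List.map x es) (x e) → SpanL (List.map y es) (y e)
  closure-coords g h φ-lin ψ-lin ψ-ker x φ-x y ψ-y closure e es x∈
    with SpanL-pull ψ-lin (preimages-scaled y h ψ-y es) (closure e es
           (subst (SpanL _) (φ-x e) (SpanL-push φ-lin (preimages-scaled x g φ-x es) x∈)))
  ... | y′ , y′∈ , eq = subst (SpanL _) (injective ψ-lin ψ-ker (trans eq (sym (ψ-y e)))) y′∈

  module _ {A : Set} {k l} (g : A → V k) (h : A → V l) (g≢0 : ∀ e → g e ≢ 𝟘)
           (g⇒h : ∀ es → Indep (List.map g es) → Indep (List.map h es))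
           (h⇒g : ∀ es → Indep (List.map h es) → Indep (List.map g es)) where

    -- Coordinates relative to the common basis `us` differ by a diagonal matrix and scalars. The
    -- matrix is absorbed into `ψ`.
    common-coordinates-via : ∀ us → Indep (List.map g us) →
      (x : A → V (length us)) → (∀ e → combine-by g us (x e) ≡ g e) →
      (y : A → V (length us)) → (∀ e → combine-by h us (y e) ≡ h e) →
      ∀ es → (∀ e → e ∈ es) → CommonCoordinates g h
    common-coordinates-via us ind x φ-x y ψ-y es all = from-diagonal
      (scaled-diagonally x y x≢0 (List.lookup us) x-u y-u
        (closure-coords g h φ-linear ψ-linear ψ-kernel x φ-x y ψ-y (closure-transfer g h g⇒h h⇒g))
        (closure-coords h g ψ-linear φ-linear φ-kernel y ψ-y x φ-x (closure-transfer h g h⇒g g⇒h))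
        es)
      where
      n : ℕ
      n = length us
      φ : V n → V k
      φ = combine-by g us
      ψ : V n → V l
      ψ = combine-by h us
      φ-linear : Linear φ
      φ-linear = combine-by-linear g us
      ψ-linear : Linear ψ
      ψ-linear = combine-by-linear h us
      φ-kernel : TrivialKernel φ
      φ-kernel = combine-by-kernel g us ind
      ψ-kernel : TrivialKernel ψ
      ψ-kernel = combine-by-kernel h us (g⇒h us ind)
      x≢0 : ∀ e → x e ≢ 𝟘
      x≢0 e eq = g≢0 e (trans (sym (φ-x e)) (trans (cong φ eq) (0-homo φ-linear)))
      x-u : ∀ i → x (List.lookup us i) ≡ unit i
      x-u i = injective φ-linear φ-kernel (trans (φ-x _) (sym (combine-by-unit g us i)))
      y-u : ∀ i → y (List.lookup us i) ≡ unit i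
      y-u i = injective ψ-linear ψ-kernel (trans (ψ-y _) (sym (combine-by-unit h us i)))
      from-diagonal : (∃ λ s → NonzeroEntries s ×
        (∀ {e} → e ∈ es → ∃ λ c → c ≢ 0ᶠ × y e ≡ c ⊙ diag s (x e))) → CommonCoordinates g h
      from-diagonal (s , s≢0 , scaled) = record
        { φ = φ
        ; φ-linear = φ-linear
        ; φ-kernel = φ-kernel
        ; ψ = λ u → ψ (diag s u)
        ; ψ-linear = record
          { +-homo = λ u v → trans (cong ψ (+-homo (diag-linear s) u v)) (+-homo ψ-linear _ _)
          ; ⊙-homo = λ c v → trans (cong ψ (⊙-homo (diag-linear s) c v)) (⊙-homo ψ-linear c _)
          }
        ; ψ-kernel = λ u eq → trans (sym (diag-involutive s≢0 u))
            (trans (cong (diag s) (ψ-kernel _ eq)) (0-homo (diag-linear s)))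
        ; x = x
        ; φ-x = φ-x
        ; ψ-x = λ e → let c , c≢0 , eq = scaled (all e) in
            c , c≢0 , trans (sym (ψ-y e)) (trans (cong ψ eq) (⊙-homo ψ-linear c _))
        }

    common-coordinates : ∀ es → (∀ e → e ∈ es) → CommonCoordinates g h
    common-coordinates es all with extract-basis g es
    ... | us , _ , ind , spans-all = common-coordinates-via us ind
      (proj₁ ∘ x) (proj₂ ∘ x) (proj₁ ∘ y) (proj₂ ∘ y) es all
      where
      x : ∀ e → ∃ λ cs → combine-by g us cs ≡ g e
      x e = SpanL⇒combine-by g us (spans-all (all e))
      y : ∀ e → ∃ λ cs → combine-by h us cs ≡ h e
      y e = SpanL⇒combine-by h us (closure-transfer g h g⇒h h⇒g e us (spans-all (all e)))

  point : ∀ {m} (S : PSet F m) {v} → ⟦ S ⟧ v → ∃ λ (e : Elem S) → vecOf {T = S} e ≡ lead v ⊙ v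
  point S {v} (v≢0 , v∈) = (toPt v v≢0 , trans (sym (colour-toPt S v≢0)) v∈) , refl

  module _ {k l} {T : PSet F k} {U : PSet F l} (iso : Elem T ↔ Elem U)
           (cc : CommonCoordinates (vecOf {T = T}) (λ e → vecOf {T = U} (Inverse.to iso e))) where

    open CommonCoordinates cc

    coordinates-onto : ∀ {v} → ⟦ T ⟧ v → ∃ λ u → φ u ≡ v
    coordinates-onto {v} v∈ with point T v∈
    ... | e , eq = lead v ⊙ x e , trans (⊙-homo φ-linear (lead v) (x e))
          (trans (cong (lead v ⊙_) (trans (φ-x e) eq)) (⊙-involutive v (lead≢0 v)))

    private
      T⇒U : ∀ {u} → u ≢ 𝟘 → colour T (φ u) ≡ true → colour U (ψ u) ≡ true
      T⇒U {u} u≢0 v∈ with point T ((u≢0 ∘ φ-kernel u) , v∈)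
      ... | e , eq with ψ-x e
      ...   | c , c≢0 , he = trans (sym (colour-⊙ U (·-nonzero c≢0 (lead≢0 (φ u))) (u≢0 ∘ ψ-kernel u)))
              (trans (cong (colour U) (sym he-scaled)) (trans (colour-pt U _) (proj₂ (Inverse.to iso e))))
        where
        x-scaled : x e ≡ lead (φ u) ⊙ u
        x-scaled = injective φ-linear φ-kernel
          (trans (φ-x e) (trans eq (sym (⊙-homo φ-linear _ u))))
        he-scaled : vecOf {T = U} (Inverse.to iso e) ≡ (c · lead (φ u)) ⊙ ψ u
        he-scaled = trans he (trans (cong (λ w → c ⊙ ψ w) x-scaled)
          (trans (cong (c ⊙_) (⊙-homo ψ-linear _ u)) (⊙-assoc c _ (ψ u))))

      U⇒T : ∀ {u} → u ≢ 𝟘 → colour U (ψ u) ≡ true → colour T (φ u) ≡ true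
      U⇒T {u} u≢0 v∈ with point U ((u≢0 ∘ ψ-kernel u) , v∈)
      ... | f , eq with ψ-x (Inverse.from iso f)
      ...   | c , c≢0 , he = trans (sym (colour-⊙ T (·-nonzero c≢0 (lead≢0 (ψ u))) (u≢0 ∘ φ-kernel u)))
              (trans (cong (colour T) (sym ge-scaled)) (trans (colour-pt T _) (proj₂ e)))
        where
        e : Elem T
        e = Inverse.from iso f
        x-scaled : c ⊙ x e ≡ lead (ψ u) ⊙ u
        x-scaled = injective ψ-linear ψ-kernel (trans (⊙-homo ψ-linear c (x e)) (trans (sym he)
          (trans (cong (vecOf {T = U}) (Inverse.strictlyInverseˡ iso f)) (trans eq (sym (⊙-homo ψ-linear _ u))))))
        ge-scaled : vecOf {T = T} e ≡ (c · lead (ψ u)) ⊙ φ u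
        ge-scaled = trans (sym (φ-x e)) (trans (cong φ
          (trans (sym (⊙-involutive (x e) c≢0)) (trans (cong (c ⊙_) x-scaled) (⊙-assoc c _ u))))
          (⊙-homo φ-linear _ u))

    coordinates-agree : ∀ u → u ≢ 𝟘 → colour T (φ u) ≡ colour U (ψ u)
    coordinates-agree u u≢0 = bool-≡ (T⇒U u≢0) (U⇒T u≢0)

    -- Goodness is pulled back along `ψ` to the coordinate space and pushed forward along `φ`, whose
    -- range contains all of `T`.
    Good-coordinates : Good (colour U) → Good (colour T)
    Good-coordinates goodU W W? sub nz = Goodᵂ-push φ-linear φ-kernel {χ = colour T} coordinates-agree
      (Good-pull ψ-linear ψ-kernel {χ = colour U} (λ _ _ → refl) goodU) W? sub nz
      (λ (_ , v∈) → coordinates-onto v∈)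

  Good-iso : ∀ {k l} {T : PSet F k} {U : PSet F l} → MatIso F T U → Good (colour U) → Good (colour T)
  Good-iso {T = T} {U} (iso , lin-ind) = Good-coordinates {T = T} {U} iso
    (common-coordinates _ _ (λ e → pt≢0 (proj₁ e))
      (λ es ind → LinInd⇒Indep _ (proj₁ (lin-ind es) (Indep⇒LinInd _ ind)))
      (λ es ind → LinInd⇒Indep _ (proj₂ (lin-ind es) (Indep⇒LinInd _ ind)))
      (allElems T) (∈-allElems T))

-- Equivalence of comatroids and good sets.

module Comatroids (F : Field) where

  open Linear F
  open Colourings F
  open Points F
  open Flats F
  open DirectSums F
  open Isomorphisms F

  SameRankᵛ-resp : ∀ {k} {P P′ Q Q′ : V k → Set} → P ≐ P′ → Q ≐ Q′ → SameRankᵛ P Q → SameRankᵛ P′ Q′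
  SameRankᵛ-resp P≐P′ Q≐Q′ (as , bs , A , B , len) =
    as , bs , Basis-resp P≐P′ A , Basis-resp Q≐Q′ B , len

  SameRankᵛ-sym : ∀ {k} {P Q : V k → Set} → SameRankᵛ P Q → SameRankᵛ Q P
  SameRankᵛ-sym (as , bs , A , B , len) = bs , as , B , A , sym len

  Mono-not : ∀ {k} (S : PSet F k) b (W : V k → Set) →
    Mono (colour (not ∘ S)) b W ≐ Mono (colour S) (not b) W
  Mono-not S b W =
    (λ (w , v≢0 , eq) → w , v≢0 ,
      trans (sym (Boolₚ.not-involutive _)) (cong not (trans (sym (colour-not S v≢0)) eq))) ,
    (λ (w , v≢0 , eq) → w , v≢0 ,
      trans (colour-not S v≢0) (trans (cong not eq) (Boolₚ.not-involutive b)))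

  Good-not : ∀ {k} {S : PSet F k} → Good (colour S) → Good (colour (not ∘ S))
  Good-not {S = S} good W W? sub nz same =
    [ (λ D → inj₂ (Disc-resp (≐-sym (Mono-not S false W)) D))
    , (λ D → inj₁ (Disc-resp (≐-sym (Mono-not S true W)) D)) ]′
    (good W W? sub nz
      (SameRankᵛ-sym (SameRankᵛ-resp (Mono-not S true W) (Mono-not S false W) same)))

  IsCo⇒Good : ∀ {k} {T : PSet F k} → IsCo F T → Good (colour T)
  IsCo⇒Good co-empty W W? sub ([] , _ , nz) = contradiction refl nz
  IsCo⇒Good (co-sum {T = T} {U} coT coU) = Good-dsum T U (IsCo⇒Good coT) (IsCo⇒Good coU)
  IsCo⇒Good (co-compl {T = T} coT t S iso) = Good-not {S = S} (Good-iso {T = S} {T} iso (IsCo⇒Good coT))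
  IsCo⇒Good (co-iso {T = T} {U} coT iso) = Good-iso {T = U} {T} iso (IsCo⇒Good coT)

  module _ {n k} {φ : V n → V k} (lin : Linear φ) (ker : TrivialKernel φ) where

    -- Injective linear maps and nonzero scalars preserve independence both ways, so taking
    -- preimages and normalising is a matroid isomorphism.
    linear-iso : (T : PSet F k) (T′ : PSet F n) →
      (∀ u → u ≢ 𝟘 → colour T (φ u) ≡ colour T′ u) →
      (∀ {v} → ⟦ T ⟧ v → ∃ λ u → φ u ≡ v) → MatIso F T T′
    linear-iso T T′ agree onto =
      mk↔ₛ′ to from to-from from-to ,
      λ es →
        (λ ind → Indep⇒LinInd _ (Indep-pull lin ker (rel es) (LinInd⇒Indep _ ind))) ,
        (λ ind → Indep⇒LinInd _ (Indep-push lin ker (rel es) (LinInd⇒Indep _ ind)))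
      where
      preimage : ∀ (e : Elem T) → ∃ λ u → φ u ≡ vecOf {T = T} e
      preimage (p , t) = onto (⟦⟧-pt T {p} t)
      coord : Elem T → V n
      coord e = proj₁ (preimage e)
      coord≢0 : ∀ e → coord e ≢ 𝟘
      coord≢0 e eq = pt≢0 (proj₁ e) (trans (sym (proj₂ (preimage e))) (trans (cong φ eq) (0-homo lin)))
      to : Elem T → Elem T′
      to e = toPt (coord e) (coord≢0 e) , trans (sym (colour-toPt T′ (coord≢0 e)))
        (trans (sym (agree _ (coord≢0 e)))
          (trans (cong (colour T) (proj₂ (preimage e))) (trans (colour-pt T (proj₁ e)) (proj₂ e))))
      φ≢0 : ∀ {u} → u ≢ 𝟘 → φ u ≢ 𝟘
      φ≢0 u≢0 eq = u≢0 (ker _ eq)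
      from : Elem T′ → Elem T
      from (p , t) = toPt (φ (proj₁ p)) (φ≢0 (pt≢0 p)) ,
        trans (sym (colour-toPt T (φ≢0 (pt≢0 p)))) (trans (agree _ (pt≢0 p)) (trans (colour-pt T′ p) t))
      to-from : ∀ e → to (from e) ≡ e
      to-from e@((u , nu) , t) = elem-≡ {T = T′} (begin
        nrm (coord (from e))         ≡⟨ cong nrm (injective lin ker
                                          (trans (proj₂ (preimage (from e))) (sym (⊙-homo lin (lead (φ u)) u)))) ⟩
        nrm (lead (φ u) ⊙ u)         ≡⟨ nrm-⊙ u (lead≢0 (φ u)) (normal⇒≢0 u nu) ⟩
        nrm u                        ≡⟨ normal-nrm u nu ⟩
        u ∎)
        where open ≡-Reasoning
      from-to : ∀ e → from (to e) ≡ e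
      from-to e@((v , nv) , t) = elem-≡ {T = T} (begin
        nrm (φ (nrm (coord e)))             ≡⟨ cong nrm (⊙-homo lin (lead (coord e)) (coord e)) ⟩
        nrm (lead (coord e) ⊙ φ (coord e))  ≡⟨ nrm-⊙ _ (lead≢0 (coord e)) (φ≢0 (coord≢0 e)) ⟩
        nrm (φ (coord e))                   ≡⟨ cong nrm (proj₂ (preimage e)) ⟩
        nrm v                               ≡⟨ normal-nrm v nv ⟩
        v ∎)
        where open ≡-Reasoning
      rel : ∀ es → ScaledImage φ (List.map (λ e → vecOf {T = T′} (to e)) es) (List.map (vecOf {T = T}) es)
      rel [] = []
      rel (e ∷ es) = (lead (coord e) , lead≢0 (coord e) , sym (trans
        (cong (lead (coord e) ⊙_) (⊙-homo lin (lead (coord e)) (coord e)))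
        (trans (⊙-involutive _ (lead≢0 (coord e))) (proj₂ (preimage e))))) ∷ rel es

    pullback : PSet F k → PSet F n
    pullback T p = colour T (φ (proj₁ p))

    colour-pullback : ∀ T u → u ≢ 𝟘 → colour T (φ u) ≡ colour (pullback T) u
    colour-pullback T u u≢0 = sym (trans (colour-toPt (pullback T) u≢0)
      (trans (cong (colour T) (⊙-homo lin (lead u) u)) (colour-⊙ T (lead≢0 u) (u≢0 ∘ ker u))))

    Good-pullback : ∀ T → Good (colour T) → Good (colour (pullback T))
    Good-pullback T = Good-pull lin ker {χ = colour T} (colour-pullback T)

  ≐-iso : ∀ {k} {S T : PSet F k} → (∀ p → S p ≡ T p) → MatIso F S T
  ≐-iso {S = S} {T} eq = linear-iso id-linear (λ _ e → e) S T
    (λ u u≢0 → trans (colour-toPt S u≢0) (trans (eq _) (sym (colour-toPt T u≢0))))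
    (λ {v} _ → v , refl)

  -- The map from the zero-dimensional space is injective, and there are no points for it to miss.
  empty-IsCo : ∀ {k} {E : PSet F k} → IsEmpty E → IsCo F E
  empty-IsCo {k} {E} empty = co-iso co-empty (linear-iso {φ = λ _ → 𝟘}
    (record { +-homo = λ _ _ → sym (⊕-identityˡ 𝟘) ; ⊙-homo = λ c _ → sym (⊙-zeroʳ c) })
    (λ { [] _ → refl }) E (λ _ → false)
    (λ { [] nz → contradiction refl nz })
    (λ (v≢0 , v∈) → contradiction (trans (sym v∈) (trans (colour-toPt E v≢0) (empty _))) λ ()))

  compl⁻ : ∀ {k} {E : PSet F k} → IsCo F (not ∘ E) → IsCo F E
  compl⁻ {E = E} co = co-iso
    (co-compl co _ (not ∘ E) (≐-iso {S = not ∘ E} (λ _ → refl)))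
    (≐-iso {S = E} (λ p → sym (Boolₚ.not-involutive (E p))))

  -- Induction on the dimension of the ambient space.

  module _ (k : ℕ) (IH : ∀ {j} → j < k → (E : PSet F j) → Good (colour E) → IsCo F E) where

    -- Coordinates over a basis move `E` into a space whose dimension is its rank.
    low-rank : (E : PSet F k) → Good (colour E) → ∀ {bs} → Basis ⟦ E ⟧ bs → length bs < k → IsCo F E
    low-rank E good {bs} B lt = co-iso
      (IH lt (pullback lin ker E) (Good-pullback lin ker E good))
      (linear-iso lin ker E (pullback lin ker E) (colour-pullback lin ker E)
        (λ v∈ → coeffs (spans B v∈) , comb≡ (spans B v∈)))
      where
      lin : Linear (comb′ bs)
      lin = comb′-linear bs
      ker : TrivialKernel (comb′ bs)
      ker = comb′-injective (indep B)

    -- Each part is written in coordinates over its own basis. Both ranks are positive with sum at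
    -- most `k`, so induction applies to each part.
    disconnected : (E : PSet F k) → Good (colour E) → Disc ⟦ E ⟧ → IsCo F E
    disconnected E good D with ∃basis (Disc.A? D) | ∃basis (λ v → ⟦ E ⟧? v ×-dec ¬? (Disc.A? D v))
    ... | as , BA | bs , BR = co-iso (co-sum coA coR) iso
      where
      open Disc D
      R : V k → Set
      R v = ⟦ E ⟧ v × ¬ A v
      meet : ∀ {v} → SpanL as v → SpanL bs v → v ≡ 𝟘
      meet s t = meet-trivial (SpanL⇒Span (inside BA) s) (SpanL⇒Span (inside BR) t)
      total : length as ℕ.+ length bs ≤ k
      total = subst (_≤ k) (Listₚ.length-++ as) (Indep-length (Indep-++ (indep BA) (indep BR) meet))
      nonempty : ∀ {P : V k → Set} {cs} → Basis P cs → ∃ (λ v → P v × v ≢ 𝟘) → 0 < length cs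
      nonempty {cs = []} B (v , p , v≢0) with spans B p
      ... | combo [] refl = contradiction refl v≢0
      nonempty {cs = _ ∷ _} _ _ = s≤s z≤n
      as>0 : 0 < length as
      as>0 = nonempty BA (_ , proj₂ A-nonempty , proj₁ (A⊆ (proj₂ A-nonempty)))
      bs>0 : 0 < length bs
      bs>0 = nonempty BR (_ , proj₂ rest-nonempty , proj₁ (proj₁ (proj₂ rest-nonempty)))
      linA : Linear (comb′ as)
      linA = comb′-linear as
      kerA : TrivialKernel (comb′ as)
      kerA = comb′-injective (indep BA)
      linR : Linear (comb′ bs)
      linR = comb′-linear bs
      kerR : TrivialKernel (comb′ bs)
      kerR = comb′-injective (indep BR)
      EA : PSet F (length as)
      EA = pullback linA kerA E
      ER : PSet F (length bs)
      ER = pullback linR kerR E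
      coA : IsCo F EA
      coA = IH (ℕₚ.<-≤-trans (ℕₚ.m<m+n (length as) bs>0) total) EA (Good-pullback linA kerA E good)
      coR : IsCo F ER
      coR = IH (ℕₚ.<-≤-trans (ℕₚ.m<n+m (length bs) as>0) total) ER (Good-pullback linR kerR E good)
      φ : V (length as ℕ.+ length bs) → V k
      φ v = comb′ as (Vec.take (length as) v) ⊕ comb′ bs (Vec.drop (length as) v)
      φ-linear : Linear φ
      φ-linear .+-homo u v = trans
        (cong₂ _⊕_
          (trans (cong (comb′ as) (+-homo (take-linear (length as)) u v)) (+-homo linA _ _))
          (trans (cong (comb′ bs) (+-homo (drop-linear (length as)) u v)) (+-homo linR _ _)))
        (⊕-interchange _ _ _ _)
      φ-linear .⊙-homo c v = trans
        (cong₂ _⊕_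
          (trans (cong (comb′ as) (⊙-homo (take-linear (length as)) c v)) (⊙-homo linA c _))
          (trans (cong (comb′ bs) (⊙-homo (drop-linear (length as)) c v)) (⊙-homo linR c _)))
        (sym (⊙-distribˡ c _ _))
      split : ∀ {u w} → comb′ as u ⊕ comb′ bs w ≡ 𝟘 → comb′ as u ≡ 𝟘 × comb′ bs w ≡ 𝟘
      split {u} {w} eq = as≡0 , trans (sym (⊕-identityˡ _)) (trans (cong (_⊕ comb′ bs w) (sym as≡0)) eq)
        where
        as≡0 : comb′ as u ≡ 𝟘
        as≡0 = meet (combo u refl) (sub∈ SpanL-subspace
          (subst (SpanL bs) (sym eq) (zero∈ SpanL-subspace)) (combo w refl))
      φ-kernel : TrivialKernel φ
      φ-kernel v eq with split {Vec.take (length as) v} {Vec.drop (length as) v} eq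
      ... | eqA , eqR = take,drop≡0 (length as) (kerA _ eqA) (kerR _ eqR)
      -- Membership in one part would put the component from the other span into both spans, hence
      -- make it zero.
      mixed : ∀ {u w} → u ≢ 𝟘 → w ≢ 𝟘 → colour E (comb′ as u ⊕ comb′ bs w) ≡ false
      mixed {u} {w} u≢0 w≢0 with colour E (comb′ as u ⊕ comb′ bs w) in col
      ... | false = refl
      ... | true with A? (comb′ as u ⊕ comb′ bs w)
      ...   | yes a = contradiction
              (kerR w (meet (sub∈ SpanL-subspace (subst (SpanL as) (⊕-comm _ _) (spans BA a)) (combo u refl))
                (combo w refl)))
              w≢0
      ...   | no ¬a = contradiction
              (kerA u (meet (combo u refl) (sub∈ SpanL-subspace
                (spans BR (((λ eq → u≢0 (kerA u (proj₁ (split eq)))) , col) , ¬a)) (combo w refl))))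
              u≢0
      agree : ∀ v → v ≢ 𝟘 → colour E (φ v) ≡ colour (dsumSet EA ER) v
      agree v v≢0 with Vec.take (length as) v ≟ᵛ 𝟘 | Vec.drop (length as) v ≟ᵛ 𝟘
      ... | yes take≡0 | yes drop≡0 = contradiction (take,drop≡0 (length as) take≡0 drop≡0) v≢0
      ... | yes take≡0 | no drop≢0 = trans
            (cong (colour E) (trans
              (cong (_⊕ comb′ bs (Vec.drop (length as) v)) (trans (cong (comb′ as) take≡0) (0-homo linA)))
              (⊕-identityˡ _)))
            (trans (colour-pullback linR kerR E _ drop≢0) (sym (colour-right EA ER v≢0 take≡0)))
      ... | no take≢0 | yes drop≡0 = trans
            (cong (colour E) (trans
              (cong (comb′ as (Vec.take (length as) v) ⊕_) (trans (cong (comb′ bs) drop≡0) (0-homo linR)))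
              (⊕-identityʳ _)))
            (trans (colour-pullback linA kerA E _ take≢0) (sym (colour-left EA ER v≢0 drop≡0)))
      ... | no take≢0 | no drop≢0 = trans (mixed take≢0 drop≢0) (sym (colour-mixed EA ER take≢0 drop≢0))
      onto : ∀ {v} → ⟦ E ⟧ v → ∃ λ u → φ u ≡ v
      onto {v} v∈ with A? v
      ... | yes a with spans BA a
      ...   | combo cs refl = inl (length bs) cs , trans
              (cong₂ _⊕_ (cong (comb′ as) (take-++ cs 𝟘))
                (trans (cong (comb′ bs) (drop-++ cs 𝟘)) (0-homo linR)))
              (⊕-identityʳ _)
      onto {v} v∈ | no ¬a with spans BR (v∈ , ¬a)
      ...   | combo cs refl = inr (length as) cs , trans
              (cong₂ _⊕_ (trans (cong (comb′ as) (take-++ (𝟘 {length as}) cs)) (0-homo linA))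
                (cong (comb′ bs) (drop-++ (𝟘 {length as}) cs)))
              (⊕-identityˡ _)
      iso : MatIso F E (dsumSet EA ER)
      iso = linear-iso φ-linear φ-kernel E (dsumSet EA ER) agree onto

    -- Both classes have rank `k` in the whole space, so goodness there yields a separation of `E`
    -- or of its complement. An empty basis is treated apart, since `Good` only concerns nonzero
    -- subspaces.
    full-rank : (E : PSet F k) → Good (colour E) → ∀ {as bs} → Basis ⟦ E ⟧ as → Basis ⟦ not ∘ E ⟧ bs →
      length as ≡ k → length bs ≡ k → IsCo F E
    full-rank E good {[]} BA _ _ _ = empty-IsCo empty
      where
      empty : IsEmpty E
      empty p with E p in eq
      ... | false = refl
      ... | true with spans BA (⟦⟧-pt E {p} eq)
      ...   | combo [] eq′ = contradiction (sym eq′) (pt≢0 p)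
    full-rank E good {a ∷ as} {bs} BA BB lenA lenB =
      [ (λ D → disconnected E good (Disc-resp true≐ D))
      , (λ D → compl⁻ (disconnected (not ∘ E) (Good-not {S = E} good) (Disc-resp false≐ D))) ]′
      (good (λ _ → ⊤) (λ _ → yes tt) (record { zero∈ = tt ; add∈ = λ _ _ → tt ; scale∈ = λ _ _ → tt })
        (a , tt , proj₁ (All.head (inside BA)))
        (a ∷ as , bs , Basis-resp (≐-sym true≐) BA , Basis-resp (≐-sym false≐) BB , trans lenA (sym lenB)))
      where
      true≐ : Mono (colour E) true (λ _ → ⊤) ≐ ⟦ E ⟧
      true≐ = proj₂ , (tt ,_)
      false≐ : Mono (colour E) false (λ _ → ⊤) ≐ ⟦ not ∘ E ⟧
      false≐ = (λ m → proj₂ (proj₂ (Mono-not E true (λ _ → ⊤)) m)) ,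
               (λ m → proj₁ (Mono-not E true (λ _ → ⊤)) (tt , m))

    Good⇒IsCo-step : (E : PSet F k) → Good (colour E) → IsCo F E
    Good⇒IsCo-step E good with ∃basis ⟦ E ⟧? | ∃basis ⟦ not ∘ E ⟧?
    ... | as , BA | bs , BB with length as ℕₚ.<? k | length bs ℕₚ.<? k
    ...   | yes lt | _ = low-rank E good BA lt
    ...   | no _ | yes lt = compl⁻ (low-rank (not ∘ E) (Good-not {S = E} good) BB lt)
    ...   | no as≮k | no bs≮k = full-rank E good BA BB (full BA as≮k) (full BB bs≮k)
      where
      full : ∀ {P : V k → Set} {cs} → Basis P cs → ¬ (length cs < k) → length cs ≡ k
      full B ≮k = ℕₚ.≤-antisym (Indep-length (indep B)) (ℕₚ.≮⇒≥ ≮k)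

  Good⇒IsCo : ∀ {k} (E : PSet F k) → Good (colour E) → IsCo F E
  Good⇒IsCo {k} = <-rec (λ k → (E : PSet F k) → Good (colour E) → IsCo F E)
    (λ k IH → Good⇒IsCo-step k (λ lt → IH lt)) k

theorem1p1 : (F : Field) (k : ℕ) (E : PSet F k) → IsRank F E k →
    let Cond = IsEmpty E ⊎
          ((Fl : PSet F k) → IsFlat F Fl → NonEmpty Fl →
            SameRank F (Fl ∩ E) (Fl ─ E) →
            Disconnected F (Fl ∩ E) ⊎ Disconnected F (Fl ─ E))
    in (IsCo F E → Cond) × (Cond → IsCo F E)
theorem1p1 F k E _ =
  (λ co → inj₂ (Good⇒Condition {E = E} (IsCo⇒Good co))) ,
  [ empty-IsCo , (λ cond → Good⇒IsCo E (Condition⇒Good {E = E} cond)) ]′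
  where
  open Flats F
  open Comatroids F
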